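{- The coefficients of the compositional inverse $g^{\langle -1 \rangle}(x)=x+b_1x^2+b_2x^3+\dots$ of $g(x)=x+a_1x^2+a_2x^3+\dots$ are determined by $$ b_n = \sum_{\pi \in NC(\mathtt{p}_n)} (-1)^{|\pi|}C_{(\overline{\pi}:\pi)}\,a_{|\pi_1|} a_{|\pi_2|} \dots a_{|\pi_r|}, $$ where $\pi=\{\pi_1,\dots,\pi_r\}$.
   Context: $\mathtt{p}_n=12\dots n$ denotes the standard path on $[n]$, and $NC(\mathtt{p}_n)$ is the set of noncrossing partitions of $[n]$ (partitions such that there are no $a<b<c<d$ with $a,c$ in one block and $b,d$ in a different block); $|\pi|$ is the number of blocks. The adjacent closure $\overline{\pi}$ of $\pi$ is the noncrossing partition obtained by successively merging any two blocks $\pi_i,\pi_j$ with $\max\pi_i+1=\min\pi_j$. Then $C_{(\overline{\pi}:\pi)}=\prod_{\pi'_i\in\overline{\pi}} C_{n_i}$, where $C_m$ is the $m$-th Catalan number and $n_i$ is the number of blocks of $\pi$ contained in the block $\pi'_i$ of $\overline{\pi}$. -}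

module Defs where

open import Level using (Level)
open import Data.Bool using (Bool; true; false; _∧_; not; if_then_else_)
open import Data.Nat using (ℕ; zero; suc; _⊔_; _⊓_; _≡ᵇ_; _<ᵇ_; _/_; _∸_)
import Data.Nat as ℕ
open import Data.Nat.Combinatorics using (_C_)
open import Data.List using (List; []; _∷_; [_]; map; concatMap; concat; upTo; foldr; length)
open import Data.Bool.ListAction using (any)
open import Data.Product using (_×_; _,_)
open import Algebra.Bundles using (CommutativeRing)

catalan : ℕ → ℕ
catalan m = ((2 ℕ.* m) C m) / suc m

-- Set partitions of [n] = {1,…,n}, as lists of blocks (lists of ℕ).
-- Every set partition of [n] occurs exactly once in `partitions n`:
-- a partition of [n+1] arises from a unique partition of [n] by either
-- adding {n+1} as a new block or inserting n+1 into one existing block.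

Block : Set
Block = List ℕ

Partition : Set
Partition = List Block

insertEverywhere : ℕ → Partition → List Partition
insertEverywhere x []      = []
insertEverywhere x (B ∷ π) = ((x ∷ B) ∷ π) ∷ map (B ∷_) (insertEverywhere x π)

partitions : ℕ → List Partition
partitions zero    = [ [] ]
partitions (suc n) =
  concatMap (λ π → ([ suc n ] ∷ π) ∷ insertEverywhere (suc n) π) (partitions n)

range : ℕ → List ℕ
range n = map suc (upTo n)

_∈ᵇ_ : ℕ → Block → Bool
x ∈ᵇ B = any (x ≡ᵇ_) B

sameBlock : Partition → ℕ → ℕ → Bool
sameBlock π x y = any (λ B → (x ∈ᵇ B) ∧ (y ∈ᵇ B)) π

crossing : ℕ → Partition → Bool
crossing n π =
  any (λ a → any (λ b → any (λ c → any (λ d →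
        (a <ᵇ b) ∧ (b <ᵇ c) ∧ (c <ᵇ d)
      ∧ sameBlock π a c ∧ sameBlock π b d ∧ not (sameBlock π a b))
    (range n)) (range n)) (range n)) (range n)

filterᵇ : {A : Set} → (A → Bool) → List A → List A
filterᵇ p []       = []
filterᵇ p (x ∷ xs) = if p x then x ∷ filterᵇ p xs else filterᵇ p xs

NC : ℕ → List Partition
NC n = filterᵇ (λ π → not (crossing n π)) (partitions n)

-- Adjacent closure.  We keep track, for every block of the closure, of
-- the list of blocks of π it is the union of (a "group").  Starting from
-- the groups [B] for B ∈ π, we successively merge two groups G, G' with
-- max G + 1 = min G' until no such pair exists.

maxL : List ℕ → ℕ
maxL = foldr _⊔_ 0

minL : List ℕ → ℕ
minL []       = 0
minL (x ∷ xs) = foldr _⊓_ x xs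

Group : Set
Group = List Block

picks : {A : Set} → List A → List (A × List A)
picks []       = []
picks (x ∷ xs) = (x , xs) ∷ map (λ { (y , ys) → (y , x ∷ ys) }) (picks xs)

adjacent : Group → Group → Bool
adjacent G G' = suc (maxL (concat G)) ≡ᵇ minL (concat G')

mergeSteps : List Group → List (List Group)
mergeSteps gs =
  concatMap (λ { (G , rest) →
    concatMap (λ { (G' , rest') →
      if adjacent G G' then [ (G ++ᴳ G') ∷ rest' ] else [] })
      (picks rest) })
    (picks gs)
  where
  _++ᴳ_ : Group → Group → Group
  []      ++ᴳ H = H
  (x ∷ G) ++ᴳ H = x ∷ (G ++ᴳ H)

closeGroups : ℕ → List Group → List Group
closeGroups zero    gs = gs
closeGroups (suc k) gs with mergeSteps gs
... | []       = gs
... | gs' ∷ _  = closeGroups k gs'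

-- the blocks of the adjacent closure of π, each given as the list of
-- blocks of π it contains (fuel |π| suffices: each step removes a group)
adjacentClosure : Partition → List Group
adjacentClosure π = closeGroups (length π) (map [_] π)

catalanCoeff : Partition → ℕ
catalanCoeff π = foldr (λ G r → catalan (length G) ℕ.* r) 1 (adjacentClosure π)

module Series {c ℓ : Level} (R : CommutativeRing c ℓ) where
  open CommutativeRing R using (Carrier; _≈_; _+_; _*_; -_; 0#; 1#)

  Ser : Set c
  Ser = ℕ → Carrier

  sumTo : ℕ → (ℕ → Carrier) → Carrier
  sumTo zero    f = f zero
  sumTo (suc n) f = sumTo n f + f (suc n)

  fromℕ : ℕ → Carrier
  fromℕ zero    = 0#
  fromℕ (suc n) = 1# + fromℕ n

  signPow : ℕ → Carrier
  signPow zero    = 1#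
  signPow (suc k) = - (signPow k)

  one : Ser
  one zero    = 1#
  one (suc _) = 0#

  X : Ser
  X zero          = 0#
  X (suc zero)    = 1#
  X (suc (suc _)) = 0#

  _·_ : Ser → Ser → Ser
  (f · g) n = sumTo n (λ i → f i * g (n ∸ i))

  _^ˢ_ : Ser → ℕ → Ser
  f ^ˢ zero  = one
  f ^ˢ suc k = f · (f ^ˢ k)

  -- composition f(h(x)) for h with zero constant term:
  -- [x^n] f(h(x)) = Σ_{k=0}^{n} f_k [x^n] h(x)^k
  _∘ˢ_ : Ser → Ser → Ser
  (f ∘ˢ h) n = sumTo n (λ k → f k * (h ^ˢ k) n)

  -- h is the compositional inverse of f (both have zero constant term)
  IsCompInverse : Ser → Ser → Set ℓ
  IsCompInverse f h = (∀ n → (f ∘ˢ h) n ≈ X n) × (∀ n → (h ∘ˢ f) n ≈ X n)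

  -- x + a₁ x² + a₂ x³ + …  (the value a 0 is not used)
  shiftSer : (ℕ → Carrier) → Ser
  shiftSer a zero          = 0#
  shiftSer a (suc zero)    = 1#
  shiftSer a (suc (suc m)) = a (suc m)

  sumL : List Carrier → Carrier
  sumL = foldr _+_ 0#

  prodL : List Carrier → Carrier
  prodL = foldr _*_ 1#

  ncFormula : (ℕ → Carrier) → ℕ → Carrier
  ncFormula a n = sumL (map (λ π →
      signPow (length π) * (fromℕ (catalanCoeff π) * prodL (map (λ B → a (length B)) π)))
    (NC n))

{-# OPTIONS --safe #-}
module Submission where

-- With w s = - a s, the compositional inverse of x + a₁x² + a₂x³ + … is x D(x), where D = 1 + U D²
-- and U = Σ_{s ≥ 1} w s xˢ Dˢ⁻¹. On the other side, the outer blocks of a noncrossing partition of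
-- [n] form a single chain of the adjacent closure, and n + 1 may either become a new outer block or
-- join an outer block; in the latter case the outer blocks to its right become nested, and their
-- chain is final. Hence the ways to complete a noncrossing partition depend only on the sizes of
-- its outer blocks, and their generating function has a closed form in D, which equals D itself
-- for the empty partition. The Catalan convolution identity enters there because
-- D = Σ_k C_k Uᵏ is a solution of D = 1 + U D².

open import Defs
open import Level using (Level)
open import Data.Bool using (Bool; true; false; T; not; if_then_else_)
open import Data.Bool.ListAction using (any)
open import Data.Bool.Properties using (T-≡; T-∧)
open import Data.Empty using (⊥; ⊥-elim)
open import Data.Integer using () renaming (+_ to pos)
import Data.Integer as ℤ
import Data.Integer.Properties as ℤ
open import Data.List using (List; []; _∷_; [_]; _++_; map; concat; concatMap; foldr; length)
import Data.List.Properties as List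
open import Data.List.Membership.Propositional using (_∈_; find; lose)
open import Data.List.Membership.Propositional.Properties
  using (∈-++⁻; ∈-++⁺ˡ; ∈-++⁺ʳ; ∈-∃++; ∈-map⁺; ∈-map⁻; ∈-concatMap⁺; ∈-concatMap⁻; ∈-upTo⁺; ∈-upTo⁻)
open import Data.List.Relation.Binary.Permutation.Propositional
  using (_↭_; prep; swap; ↭-refl; ↭-sym; ↭-trans; ↭-reflexive)
import Data.List.Relation.Binary.Permutation.Propositional as ↭
open import Data.List.Relation.Binary.Permutation.Propositional.Properties
  using (All-resp-↭; ∈-resp-↭; map⁺; ↭-length; ++⁺ˡ; ++⁺ʳ; shift; shifts; drop-mid; drop-∷; ++-comm; ¬x∷xs↭[])
open import Data.List.Relation.Unary.All as All using (All; []; _∷_)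
import Data.List.Relation.Unary.All.Properties as All
open import Data.List.Relation.Unary.Any as Any using (Any; here; there)
import Data.List.Relation.Unary.Any.Properties as Any
open import Data.Nat using (ℕ; zero; suc; _∸_; _⊓_; _≤_; _<_; z≤n; s≤s; _≡ᵇ_; _<ᵇ_)
import Data.Nat as ℕ
open import Data.Nat.Combinatorics using (_C_; nCk+nC[k+1]≡[n+1]C[k+1]; nCk≡nC[n∸k])
import Data.Nat.DivMod as ℕ
import Data.Nat.Divisibility as ℕ
open import Data.Nat.ListAction using (sum; product)
open import Data.Nat.ListAction.Properties using (product-↭; product-++)
import Data.Nat.Properties as ℕ
import Data.Nat.Solver
open import Data.Product using (_×_; _,_; proj₁; proj₂; ∃; ∃₂)
open import Data.Sum using (_⊎_; inj₁; inj₂)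
open import Algebra.Bundles using (CommutativeRing; module AbelianGroup)
import Algebra.Construct.Pointwise as Pointwise
import Algebra.Properties.Group as GroupProperties
import Algebra.Properties.Ring as RingProperties
import Algebra.Solver.Ring.NaturalCoefficients.Default as NaturalCoefficients
open import Function.Base using (_∘_)
open import Function.Bundles using (_⇔_; mk⇔; Equivalence)
open import Relation.Binary.Bundles using (Setoid)
open import Relation.Binary.PropositionalEquality as ≡ using (_≡_)
import Relation.Binary.Reasoning.Setoid as SetoidReasoning
open import Relation.Nullary using (¬_)

-- With `w s = - a s`, the equation `g(y) = x` reads `y = x + Σ w s y^(s+1)`, and the substitution
-- `y = x D` turns it into `D = 1 + U D²`. Here `U` is the series of one outer block of any size `s`
-- whose `s - 1` inner gaps are each filled by a `D`, and `D = Σ C_k Uᵏ` says that an interval is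
-- filled by a chain of `k` such blocks carrying the Catalan factor of the chain. This decomposition
-- cannot be read off the enumeration: `partitions` inserts 1, 2, ..., n one at a time, and a block
-- keeps receiving elements after others have been started. Therefore no bijection is built. Each
-- noncrossing partition of [n] carries the series of its completions, and the sum of their m-th
-- coefficients over all noncrossing partitions of [n] depends on `n + m` only: for `n = 0` it is a
-- coefficient of `D`, for `m = 0` it is the formula.

-- Formal power series: ring structure, composition, fixed points.

module PowerSeries {c ℓ : Level} (R : CommutativeRing c ℓ) where
  open CommutativeRing R
  open Series R
  open SetoidReasoning setoid
  private module S = NaturalCoefficients commutativeSemiring

  infix 4 _≋_ _≈[_]_
  infixl 7 _•_

  _≋_ : Ser → Ser → Set ℓ
  f ≋ g = ∀ n → f n ≈ g n

  _≈[_]_ : Ser → ℕ → Ser → Set ℓ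
  f ≈[ n ] g = ∀ i → i < n → f i ≈ g i

  0ˢ : Ser
  0ˢ _ = 0#

  _+ˢ_ : Ser → Ser → Ser
  (f +ˢ g) n = f n + g n

  _•_ : Carrier → Ser → Ser
  (r • f) n = r * f n

  tail : Ser → Ser
  tail f n = f (suc n)

  sumTo-cong : ∀ n {f g} → (∀ i → i ≤ n → f i ≈ g i) → sumTo n f ≈ sumTo n g
  sumTo-cong zero    e = e 0 z≤n
  sumTo-cong (suc n) e =
    +-cong (sumTo-cong n (λ i i≤n → e i (ℕ.m≤n⇒m≤1+n i≤n))) (e (suc n) ℕ.≤-refl)

  sumTo-+ : ∀ n f g → sumTo n (λ i → f i + g i) ≈ sumTo n f + sumTo n g
  sumTo-+ zero    f g = refl
  sumTo-+ (suc n) f g = trans (+-congʳ (sumTo-+ n f g))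
    (S.solve 4 (λ a b c d → (a S.:+ b) S.:+ (c S.:+ d) S.:= (a S.:+ c) S.:+ (b S.:+ d)) refl _ _ _ _)

  sumTo-*ˡ : ∀ n r f → sumTo n (λ i → r * f i) ≈ r * sumTo n f
  sumTo-*ˡ zero    r f = refl
  sumTo-*ˡ (suc n) r f = trans (+-congʳ (sumTo-*ˡ n r f)) (sym (distribˡ r _ _))

  sumTo-0 : ∀ n {f} → (∀ i → i ≤ n → f i ≈ 0#) → sumTo n f ≈ 0#
  sumTo-0 zero    e = e 0 z≤n
  sumTo-0 (suc n) e = trans
    (+-cong (sumTo-0 n (λ i i≤n → e i (ℕ.m≤n⇒m≤1+n i≤n))) (e (suc n) ℕ.≤-refl)) (+-identityˡ 0#)

  sumTo-suc : ∀ n f → sumTo (suc n) f ≈ f 0 + sumTo n (tail f)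
  sumTo-suc zero    f = refl
  sumTo-suc (suc n) f = trans (+-congʳ (sumTo-suc n f)) (+-assoc _ _ _)

  ·-suc : ∀ f g n → (f · g) (suc n) ≈ f 0 * g (suc n) + (tail f · g) n
  ·-suc f g n = sumTo-suc n (λ i → f i * g (suc n ∸ i))

  ·-cong-≤ : ∀ {f f′ g g′} n → (∀ i → i ≤ n → f i ≈ f′ i) → (∀ i → i ≤ n → g i ≈ g′ i) →
             (f · g) n ≈ (f′ · g′) n
  ·-cong-≤ n e e′ = sumTo-cong n (λ i i≤n → *-cong (e i i≤n) (e′ (n ∸ i) (ℕ.m∸n≤m n i)))

  ·-cong : ∀ {f f′ g g′} → f ≋ f′ → g ≋ g′ → (f · g) ≋ (f′ · g′)
  ·-cong e e′ n = ·-cong-≤ n (λ i _ → e i) (λ i _ → e′ i)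

  ·-cong-[] : ∀ {f f′ g g′} n → f ≈[ n ] f′ → g ≈[ n ] g′ → (f · g) ≈[ n ] (f′ · g′)
  ·-cong-[] n e e′ i i<n = ·-cong-≤ i (λ j j≤i → e j (ℕ.≤-<-trans j≤i i<n))
                                      (λ j j≤i → e′ j (ℕ.≤-<-trans j≤i i<n))

  -- Coefficient `i + 1` of `h · u` sees `u` only up to `i`. This gain of one coefficient drives the
  -- inductions on precision below: the order of powers, the laws of composition, and fixed points.
  ·-contractive : ∀ {h u v} n → h 0 ≈ 0# → u ≈[ n ] v → (h · u) ≈[ suc n ] (h · v)
  ·-contractive {h} {u} {v} n h0 e zero _ =
    trans (trans (*-congʳ h0) (zeroˡ _)) (sym (trans (*-congʳ h0) (zeroˡ _)))
  ·-contractive {h} {u} {v} n h0 e (suc i) (s≤s i<n) = begin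
    (h · u) (suc i)                       ≈⟨ ·-suc h u i ⟩
    h 0 * u (suc i) + (tail h · u) i      ≈⟨ +-cong (trans (*-congʳ h0) (zeroˡ _))
                                               (·-cong-[] {f = tail h} n (λ _ _ → refl) e i i<n) ⟩
    0# + (tail h · v) i                   ≈⟨ +-congʳ (trans (*-congʳ h0) (zeroˡ _)) ⟨
    h 0 * v (suc i) + (tail h · v) i      ≈⟨ ·-suc h v i ⟨
    (h · v) (suc i)                       ∎

  ·-distribʳ : ∀ f g h → ((g +ˢ h) · f) ≋ ((g · f) +ˢ (h · f))
  ·-distribʳ f g h n = trans (sumTo-cong n (λ i _ → distribʳ (f (n ∸ i)) (g i) (h i))) (sumTo-+ n _ _)

  •-·-assoc : ∀ r f g → ((r • f) · g) ≋ (r • (f · g))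
  •-·-assoc r f g n = trans (sumTo-cong n (λ i _ → *-assoc r (f i) (g (n ∸ i)))) (sumTo-*ˡ n r _)

  ·-assoc : ∀ f g h → ((f · g) · h) ≋ (f · (g · h))
  ·-assoc f g h zero    = *-assoc _ _ _
  ·-assoc f g h (suc n) = begin
    ((f · g) · h) (suc n)
      ≈⟨ ·-suc (f · g) h n ⟩
    f 0 * g 0 * h (suc n) + (tail (f · g) · h) n
      ≈⟨ +-congˡ (·-cong {g = h} (·-suc f g) (λ _ → refl) n) ⟩
    f 0 * g 0 * h (suc n) + (((f 0 • tail g) +ˢ (tail f · g)) · h) n
      ≈⟨ +-congˡ (·-distribʳ h _ _ n) ⟩
    f 0 * g 0 * h (suc n) + (((f 0 • tail g) · h) n + ((tail f · g) · h) n)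
      ≈⟨ +-congˡ (+-cong (•-·-assoc (f 0) (tail g) h n) (·-assoc (tail f) g h n)) ⟩
    f 0 * g 0 * h (suc n) + (f 0 * (tail g · h) n + (tail f · (g · h)) n)
      ≈⟨ S.solve 5 (λ a b c d e → a S.:* b S.:* c S.:+ (a S.:* d S.:+ e) S.:=
                                   a S.:* (b S.:* c S.:+ d) S.:+ e) refl _ _ _ _ _ ⟩
    f 0 * (g 0 * h (suc n) + (tail g · h) n) + (tail f · (g · h)) n
      ≈⟨ +-congʳ (*-congˡ (·-suc g h n)) ⟨
    f 0 * (g · h) (suc n) + (tail f · (g · h)) n
      ≈⟨ ·-suc f (g · h) n ⟨
    (f · (g · h)) (suc n) ∎

  ·-comm : ∀ f g → (f · g) ≋ (g · f)
  ·-comm f g zero          = *-comm _ _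
  ·-comm f g (suc zero)    =
    S.solve 4 (λ a b c d → a S.:* b S.:+ c S.:* d S.:= d S.:* c S.:+ b S.:* a) refl _ _ _ _
  ·-comm f g (suc (suc n)) = begin
    (f · g) (suc (suc n))
      ≈⟨ ·-suc f g (suc n) ⟩
    f 0 * g (suc (suc n)) + (tail f · g) (suc n)
      ≈⟨ +-congˡ (trans (·-comm (tail f) g (suc n)) (·-suc g (tail f) n)) ⟩
    f 0 * g (suc (suc n)) + (g 0 * f (suc (suc n)) + (tail g · tail f) n)
      ≈⟨ +-congˡ (+-congˡ (·-comm (tail g) (tail f) n)) ⟩
    f 0 * g (suc (suc n)) + (g 0 * f (suc (suc n)) + (tail f · tail g) n)
      ≈⟨ S.solve 3 (λ a b c → a S.:+ (b S.:+ c) S.:= b S.:+ (a S.:+ c)) refl _ _ _ ⟩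
    g 0 * f (suc (suc n)) + (f 0 * g (suc (suc n)) + (tail f · tail g) n)
      ≈⟨ +-congˡ (trans (·-comm (tail g) f (suc n)) (·-suc f (tail g) n)) ⟨
    g 0 * f (suc (suc n)) + (tail g · f) (suc n)
      ≈⟨ ·-suc g f (suc n) ⟨
    (g · f) (suc (suc n)) ∎

  0·f≋0 : ∀ f → (0ˢ · f) ≋ 0ˢ
  0·f≋0 f n = sumTo-0 n (λ i _ → zeroˡ _)

  one-· : ∀ f → (one · f) ≋ f
  one-· f zero    = *-identityˡ _
  one-· f (suc n) = trans (·-suc one f n)
    (trans (+-cong (*-identityˡ _) (0·f≋0 f n)) (+-identityʳ _))

  ·-one : ∀ f → (f · one) ≋ f
  ·-one f n = trans (·-comm f one n) (one-· f n)

  seriesRing : CommutativeRing c ℓ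
  seriesRing = record
    { isCommutativeRing = record
      { isRing = record
        { +-isAbelianGroup = AbelianGroup.isAbelianGroup (Pointwise.abelianGroup ℕ +-abelianGroup)
        ; *-cong           = ·-cong
        ; *-assoc          = ·-assoc
        ; *-identity       = one-· , ·-one
        ; distrib          = (λ f g h n → trans (·-comm f (g +ˢ h) n) (trans (·-distribʳ f g h n)
                                            (+-cong (·-comm g f n) (·-comm h f n))))
                           , ·-distribʳ
        }
      ; *-comm = ·-comm
      }
    }

  const : Carrier → Ser
  const r = r • one

  private
    module SR = CommutativeRing seriesRing
    module P = NaturalCoefficients SR.commutativeSemiring

  ≋-refl : ∀ {f} → f ≋ f
  ≋-refl n = refl

  ≋-sym : ∀ {f g} → f ≋ g → g ≋ f
  ≋-sym e n = sym (e n)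

  ≋-trans : ∀ {f g h} → f ≋ g → g ≋ h → f ≋ h
  ≋-trans e e′ n = trans (e n) (e′ n)

  const-· : ∀ r f → (const r · f) ≋ (r • f)
  const-· r f = ≋-trans (•-·-assoc r one f) (λ n → *-congˡ (one-· f n))

  ·-• : ∀ r f g → (f · (r • g)) ≋ (r • (f · g))
  ·-• r f g = ≋-trans (·-comm f (r • g)) (≋-trans (•-·-assoc r g f) (λ n → *-congˡ (·-comm g f n)))

  const-* : ∀ r s → const (r * s) ≋ (const r · const s)
  const-* r s = ≋-sym (≋-trans (const-· r (const s)) (λ n → sym (*-assoc r s (one n))))

  const-cong : ∀ {r s} → r ≈ s → const r ≋ const s
  const-cong e n = *-congʳ e

  const-1 : const 1# ≋ one
  const-1 n = *-identityˡ _

  const-0 : const 0# ≋ 0ˢ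
  const-0 n = zeroˡ _

  tail-X : tail X ≋ one
  tail-X zero    = refl
  tail-X (suc n) = refl

  X·-suc : ∀ f n → (X · f) (suc n) ≈ f n
  X·-suc f n = trans (·-suc X f n) (trans (+-cong (zeroˡ _)
    (trans (·-cong {g = f} tail-X ≋-refl n) (one-· f n))) (+-identityˡ _))

  X·-zero : ∀ f → (X · f) 0 ≈ 0#
  X·-zero f = zeroˡ _

  -- Composition

  ^ˢ-order : ∀ {h} → h 0 ≈ 0# → ∀ {n k} → n < k → (h ^ˢ k) n ≈ 0#
  ^ˢ-order {h} h0 {n} {suc k} n<k = trans
    (·-contractive {h} {h ^ˢ k} {0ˢ} k h0 (λ i i<k → ^ˢ-order {h} h0 i<k) n n<k)
    (trans (·-comm h 0ˢ n) (0·f≋0 h n))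

  -- `_∘ˢ_` cuts its sum off at the coefficient being computed. A bound `N` common to all
  -- coefficients lets the sum commute with multiplication by a series.
  compTo : ℕ → Ser → Ser → Ser
  compTo N f h n = sumTo N (λ k → f k * (h ^ˢ k) n)

  compTo-stable : ∀ {f h} → h 0 ≈ 0# → ∀ {n} N → n ≤ N → compTo N f h n ≈ (f ∘ˢ h) n
  compTo-stable             h0 zero    z≤n   = refl
  compTo-stable {f} {h} h0 (suc N) n≤1+N with ℕ.m≤n⇒m<n∨m≡n n≤1+N
  ... | inj₁ (s≤s n≤N) = trans (+-cong (compTo-stable {f} {h} h0 N n≤N)
          (trans (*-congˡ (^ˢ-order {h} h0 (s≤s n≤N))) (zeroʳ _))) (+-identityʳ _)
  ... | inj₂ ≡.refl    = refl

  ·-compTo : ∀ N f h g → (g · compTo N f h) ≋ (λ n → sumTo N (λ k → f k * (g · (h ^ˢ k)) n))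
  ·-compTo zero    f h g = ·-• (f 0) g one
  ·-compTo (suc N) f h g = ≋-trans
    (SR.distribˡ g (compTo N f h) (f (suc N) • (h ^ˢ suc N)))
    (λ n → +-cong (·-compTo N f h g n) (·-• (f (suc N)) g (h ^ˢ suc N) n))

  -- Horner's rule. It puts the recursive occurrence of composition under a factor `h`, where
  -- `·-contractive` makes an induction on precision possible.
  ∘-unfold : ∀ f {h} → h 0 ≈ 0# → (f ∘ˢ h) ≋ (const (f 0) +ˢ (h · (tail f ∘ˢ h)))
  ∘-unfold f {h} h0 n = begin
    (f ∘ˢ h) n                                        ≈⟨ compTo-stable {f} {h} h0 (suc n) (ℕ.n≤1+n n) ⟨
    compTo (suc n) f h n                              ≈⟨ sumTo-suc n _ ⟩
    const (f 0) n + sumTo n (λ k → f (suc k) * (h ^ˢ suc k) n)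
                                                      ≈⟨ +-congˡ (·-compTo n (tail f) h h n) ⟨
    const (f 0) n + (h · compTo n (tail f) h) n
      ≈⟨ +-congˡ (·-cong-≤ {f = h} n (λ _ _ → refl) (λ i i≤n → compTo-stable {tail f} {h} h0 n i≤n)) ⟩
    const (f 0) n + (h · (tail f ∘ˢ h)) n             ∎

  ^ˢ-cong-[] : ∀ {h h′} n → h ≈[ n ] h′ → ∀ k → (h ^ˢ k) ≈[ n ] (h′ ^ˢ k)
  ^ˢ-cong-[] n e zero    = λ _ _ → refl
  ^ˢ-cong-[] n e (suc k) = ·-cong-[] n e (^ˢ-cong-[] n e k)

  ∘-congʳ-[] : ∀ f {h h′} n → h ≈[ n ] h′ → (f ∘ˢ h) ≈[ n ] (f ∘ˢ h′)
  ∘-congʳ-[] f n e i i<n = sumTo-cong i (λ k _ → *-congˡ (^ˢ-cong-[] n e k i i<n))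

  ∘-cong : ∀ {f f′ h h′} → f ≋ f′ → h ≋ h′ → (f ∘ˢ h) ≋ (f′ ∘ˢ h′)
  ∘-cong e e′ n = sumTo-cong n
    (λ k _ → *-cong (e k) (^ˢ-cong-[] (suc n) (λ i _ → e′ i) k n ℕ.≤-refl))

  ∘-+ : ∀ f g h → ((f +ˢ g) ∘ˢ h) ≋ ((f ∘ˢ h) +ˢ (g ∘ˢ h))
  ∘-+ f g h n = trans (sumTo-cong n (λ k _ → distribʳ _ _ _)) (sumTo-+ n _ _)

  ∘-• : ∀ r f h → ((r • f) ∘ˢ h) ≋ (r • (f ∘ˢ h))
  ∘-• r f h n = trans (sumTo-cong n (λ k _ → *-assoc _ _ _)) (sumTo-*ˡ n r _)

  0∘ : ∀ h → (0ˢ ∘ˢ h) ≋ 0ˢ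
  0∘ h n = sumTo-0 n (λ k _ → zeroˡ _)

  ∘-zero : ∀ f h → (f ∘ˢ h) 0 ≈ f 0
  ∘-zero f h = *-identityʳ _

  one∘ : ∀ {h} → h 0 ≈ 0# → (one ∘ˢ h) ≋ one
  one∘ {h} h0 = ≋-trans (∘-unfold one h0) λ n → trans
    (+-cong (const-1 n) (trans (·-cong {f = h} ≋-refl (0∘ h) n) (SR.zeroʳ h n))) (+-identityʳ _)

  X∘ : ∀ {h} → h 0 ≈ 0# → (X ∘ˢ h) ≋ h
  X∘ {h} h0 = ≋-trans (∘-unfold X h0) λ n → trans
    (+-cong (const-0 n) (trans (·-cong {f = h} ≋-refl
      (≋-trans (∘-cong {h = h} tail-X ≋-refl) (one∘ h0)) n) (·-one h n)))
    (+-identityˡ _)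

  ∘X : ∀ f → (f ∘ˢ X) ≋ f
  ∘X f zero    = ∘-zero f X
  ∘X f (suc n) = trans (∘-unfold f refl (suc n))
    (trans (+-cong (zeroʳ _) (trans (X·-suc (tail f ∘ˢ X) n) (∘X (tail f) n))) (+-identityˡ _))

  truncSetoid : ℕ → Setoid c ℓ
  truncSetoid n = record
    { Carrier       = Ser
    ; _≈_           = _≈[ n ]_
    ; isEquivalence = record
      { refl  = λ _ _ → refl
      ; sym   = λ e i i<n → sym (e i i<n)
      ; trans = λ e e′ i i<n → trans (e i i<n) (e′ i i<n)
      }
    }

  ≋⇒≈[] : ∀ {f g n} → f ≋ g → f ≈[ n ] g
  ≋⇒≈[] e i _ = e i

  ≈[]⇒≋ : ∀ {f g} → (∀ n → f ≈[ n ] g) → f ≋ g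
  ≈[]⇒≋ e n = e (suc n) n ℕ.≤-refl

  +-cong-[] : ∀ {f f′ g g′ n} → f ≈[ n ] f′ → g ≈[ n ] g′ → (f +ˢ g) ≈[ n ] (f′ +ˢ g′)
  +-cong-[] e e′ i i<n = +-cong (e i i<n) (e′ i i<n)

  ∘-·-[] : ∀ n f g {h} → h 0 ≈ 0# → ((f · g) ∘ˢ h) ≈[ n ] ((f ∘ˢ h) · (g ∘ˢ h))
  ∘-·-[] zero    f g     h0 _ ()
  ∘-·-[] (suc n) f g {h} h0 = T.begin
    (f · g) ∘ˢ h
      T.≈⟨ ≋⇒≈[] (∘-unfold (f · g) h0) ⟩
    const (f 0 * g 0) +ˢ (h · (tail (f · g) ∘ˢ h))
      T.≈⟨ +-cong-[] (≋⇒≈[] (const-* (f 0) (g 0))) (·-contractive n h0 (T′.begin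
        tail (f · g) ∘ˢ h
          T′.≈⟨ ≋⇒≈[] (∘-cong {h = h} (·-suc f g) ≋-refl) ⟩
        ((f 0 • tail g) +ˢ (tail f · g)) ∘ˢ h
          T′.≈⟨ ≋⇒≈[] (∘-+ (f 0 • tail g) (tail f · g) h) ⟩
        ((f 0 • tail g) ∘ˢ h) +ˢ ((tail f · g) ∘ˢ h)
          T′.≈⟨ +-cong-[] (≋⇒≈[] (≋-trans (∘-• (f 0) (tail g) h) (≋-sym (const-· (f 0) (tail g ∘ˢ h)))))
                          (∘-·-[] n (tail f) g h0) ⟩
        (const (f 0) · (tail g ∘ˢ h)) +ˢ ((tail f ∘ˢ h) · (g ∘ˢ h)) T′.∎)) ⟩
    (const (f 0) · const (g 0)) +ˢ (h · ((const (f 0) · (tail g ∘ˢ h)) +ˢ ((tail f ∘ˢ h) · (g ∘ˢ h))))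
      T.≈⟨ ≋⇒≈[] (P.solve 6 (λ a b h p q r → a P.:* b P.:+ h P.:* (a P.:* p P.:+ q P.:* r) P.:=
                                  a P.:* (b P.:+ h P.:* p) P.:+ h P.:* (q P.:* r)) ≋-refl
                  (const (f 0)) (const (g 0)) h (tail g ∘ˢ h) (tail f ∘ˢ h) (g ∘ˢ h)) ⟩
    (const (f 0) · (const (g 0) +ˢ (h · (tail g ∘ˢ h)))) +ˢ (h · ((tail f ∘ˢ h) · (g ∘ˢ h)))
      T.≈⟨ ≋⇒≈[] (λ i → +-congʳ (·-cong {f = const (f 0)} {g = g ∘ˢ h} ≋-refl (∘-unfold g h0) i)) ⟨
    (const (f 0) · (g ∘ˢ h)) +ˢ (h · ((tail f ∘ˢ h) · (g ∘ˢ h)))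
      T.≈⟨ ≋⇒≈[] (P.solve 4 (λ a g h q → (a P.:+ h P.:* q) P.:* g P.:= a P.:* g P.:+ h P.:* (q P.:* g)) ≋-refl
                  (const (f 0)) (g ∘ˢ h) h (tail f ∘ˢ h)) ⟨
    (const (f 0) +ˢ (h · (tail f ∘ˢ h))) · (g ∘ˢ h)
      T.≈⟨ ≋⇒≈[] (·-cong {g = g ∘ˢ h} (∘-unfold f h0) ≋-refl) ⟨
    (f ∘ˢ h) · (g ∘ˢ h) T.∎
    where
    module T  = SetoidReasoning (truncSetoid (suc n))
    module T′ = SetoidReasoning (truncSetoid n)

  ∘-· : ∀ f g {h} → h 0 ≈ 0# → ((f · g) ∘ˢ h) ≋ ((f ∘ˢ h) · (g ∘ˢ h))
  ∘-· f g h0 = ≈[]⇒≋ (λ n → ∘-·-[] n f g h0)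

  ∘-assoc-[] : ∀ n f {h k} → h 0 ≈ 0# → k 0 ≈ 0# → ((f ∘ˢ h) ∘ˢ k) ≈[ n ] (f ∘ˢ (h ∘ˢ k))
  ∘-assoc-[] zero    f         h0 k0 _ ()
  ∘-assoc-[] (suc n) f {h} {k} h0 k0 = T.begin
    (f ∘ˢ h) ∘ˢ k
      T.≈⟨ ≋⇒≈[] (∘-cong {h = k} (∘-unfold f h0) ≋-refl) ⟩
    (const (f 0) +ˢ (h · (tail f ∘ˢ h))) ∘ˢ k
      T.≈⟨ ≋⇒≈[] (∘-+ (const (f 0)) (h · (tail f ∘ˢ h)) k) ⟩
    (const (f 0) ∘ˢ k) +ˢ ((h · (tail f ∘ˢ h)) ∘ˢ k)
      T.≈⟨ +-cong-[] (≋⇒≈[] (≋-trans (∘-• (f 0) one k) (λ i → *-congˡ (one∘ k0 i))))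
                     (≋⇒≈[] (∘-· h (tail f ∘ˢ h) k0)) ⟩
    const (f 0) +ˢ ((h ∘ˢ k) · ((tail f ∘ˢ h) ∘ˢ k))
      T.≈⟨ +-cong-[] {f = const (f 0)} (≋⇒≈[] ≋-refl) (·-contractive n hk0 (∘-assoc-[] n (tail f) h0 k0)) ⟩
    const (f 0) +ˢ ((h ∘ˢ k) · (tail f ∘ˢ (h ∘ˢ k)))
      T.≈⟨ ≋⇒≈[] (∘-unfold f hk0) ⟨
    f ∘ˢ (h ∘ˢ k) T.∎
    where
    module T = SetoidReasoning (truncSetoid (suc n))
    hk0 = trans (∘-zero h k) h0

  ∘-assoc : ∀ f {h k} → h 0 ≈ 0# → k 0 ≈ 0# → ((f ∘ˢ h) ∘ˢ k) ≋ (f ∘ˢ (h ∘ˢ k))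
  ∘-assoc f h0 k0 = ≈[]⇒≋ (λ n → ∘-assoc-[] n f h0 k0)

  -- Fixed points of contractions

  iterate : (Ser → Ser) → ℕ → Ser
  iterate Φ zero    = 0ˢ
  iterate Φ (suc k) = Φ (iterate Φ k)

  -- Each application of a contraction settles one more coefficient, so the limit can be read off
  -- the diagonal of the iterates.
  fix : (Ser → Ser) → Ser
  fix Φ n = iterate Φ (suc n) n

  Contraction : (Ser → Ser) → Set _
  Contraction Φ = ∀ n u v → u ≈[ n ] v → Φ u ≈[ suc n ] Φ v

  iterate-stable : ∀ {Φ} → Contraction Φ → ∀ n k → n ≤ k → iterate Φ k ≈[ n ] fix Φ
  iterate-stable {Φ} con n k n≤k i i<n = stable (suc i) k (ℕ.≤-trans i<n n≤k) i ℕ.≤-refl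
    where
    stable : ∀ m k → m ≤ k → iterate Φ k ≈[ m ] iterate Φ m
    stable zero    k       m≤k       = λ _ ()
    stable (suc m) (suc k) (s≤s m≤k) = con m _ _ (stable m k m≤k)

  fix-unfold : ∀ {Φ} → Contraction Φ → fix Φ ≋ Φ (fix Φ)
  fix-unfold {Φ} con n = con n _ _ (iterate-stable con n n ℕ.≤-refl) n ℕ.≤-refl

  fix-unique : ∀ {Φ} → Contraction Φ → ∀ {u v} → u ≋ Φ u → v ≋ Φ v → u ≋ v
  fix-unique {Φ} con {u} {v} eu ev = ≈[]⇒≋ go
    where
    go : ∀ n → u ≈[ n ] v
    go zero    _ ()
    go (suc n) i i<n = trans (eu i) (trans (con n _ _ (go n) i i<n) (sym (ev i)))

-- Catalan numbers: exactness of the division and the recurrence.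

module CatalanNumbers where
  open import Data.Nat using (_+_; _*_)
  open ≡.≡-Reasoning
  open ≡ using (cong; cong₂; sym; trans; refl)
  open Data.Nat.Solver.+-*-Solver

  [k+1]*[n+1]C[k+1] : ∀ n k → suc k * (suc n C suc k) ≡ suc n * (n C k)
  [k+1]*[n+1]C[k+1] zero    zero    = refl
  [k+1]*[n+1]C[k+1] zero    (suc k) = trans (cong (suc (suc k) *_) (sym (nCk+nC[k+1]≡[n+1]C[k+1] 0 (suc k)))) (ℕ.*-zeroʳ (suc (suc k)))
  [k+1]*[n+1]C[k+1] (suc n) k = begin
    suc k * (suc (suc n) C suc k)
      ≡⟨ cong (suc k *_) (nCk+nC[k+1]≡[n+1]C[k+1] (suc n) k) ⟨
    suc k * (suc n C k + suc n C suc k)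
      ≡⟨ ℕ.*-distribˡ-+ (suc k) (suc n C k) _ ⟩
    suc k * (suc n C k) + suc k * (suc n C suc k)
      ≡⟨ cong (suc k * (suc n C k) +_) ([k+1]*[n+1]C[k+1] n k) ⟩
    suc k * (suc n C k) + suc n * (n C k)
      ≡⟨ lower k ⟩
    suc (suc n) * (suc n C k) ∎
    where
    lower : ∀ k → suc k * (suc n C k) + suc n * (n C k) ≡ suc (suc n) * (suc n C k)
    lower zero    = refl
    lower (suc k) = begin
      suc (suc k) * (suc n C suc k) + suc n * (n C suc k)
        ≡⟨ ℕ.+-assoc (suc n C suc k) _ _ ⟩
      suc n C suc k + (suc k * (suc n C suc k) + suc n * (n C suc k))
        ≡⟨ cong (λ t → suc n C suc k + (t + suc n * (n C suc k))) ([k+1]*[n+1]C[k+1] n k) ⟩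
      suc n C suc k + (suc n * (n C k) + suc n * (n C suc k))
        ≡⟨ cong ((suc n C suc k) +_) (ℕ.*-distribˡ-+ (suc n) (n C k) _) ⟨
      suc n C suc k + suc n * (n C k + n C suc k)
        ≡⟨ cong (λ t → suc n C suc k + suc n * t) (nCk+nC[k+1]≡[n+1]C[k+1] n k) ⟩
      suc n C suc k + suc n * (suc n C suc k) ∎

  [k+1]*nC[k+1] : ∀ n k → suc k * (n C suc k) + k * (n C k) ≡ n * (n C k)
  [k+1]*nC[k+1] n k = ℕ.+-cancelʳ-≡ (n C k) _ _ (begin
    suc k * (n C suc k) + k * (n C k) + n C k
      ≡⟨ solve 3 (λ k a b → (con 1 :+ k) :* a :+ k :* b :+ b := (con 1 :+ k) :* (b :+ a)) refl k (n C suc k) (n C k) ⟩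
    suc k * (n C k + n C suc k)
      ≡⟨ cong (suc k *_) (nCk+nC[k+1]≡[n+1]C[k+1] n k) ⟩
    suc k * (suc n C suc k)
      ≡⟨ [k+1]*[n+1]C[k+1] n k ⟩
    n C k + n * (n C k)
      ≡⟨ ℕ.+-comm (n C k) _ ⟩
    n * (n C k) + n C k ∎)

  -- `eq` is `C(2m, m) = (m + 1) (C(2m, m) - C(2m, m + 1))` written without subtraction. It makes
  -- the division in `catalan` exact.
  [m+1]∣2mCm : ∀ m → suc m ℕ.∣ ((2 * m) C m)
  [m+1]∣2mCm m = ℕ.∣m+n∣m⇒∣n {n = (2 * m) C m}
    (≡.subst (suc m ℕ.∣_) (sym eq) (ℕ.m∣m*n ((2 * m) C m))) (ℕ.m∣m*n ((2 * m) C suc m))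
    where
    eq : suc m * ((2 * m) C suc m) + (2 * m) C m ≡ suc m * ((2 * m) C m)
    eq = ℕ.+-cancelʳ-≡ (m * ((2 * m) C m)) _ _ (begin
      suc m * ((2 * m) C suc m) + (2 * m) C m + m * ((2 * m) C m)
        ≡⟨ solve 3 (λ a b c → a :+ b :+ c := a :+ c :+ b) refl (suc m * ((2 * m) C suc m)) ((2 * m) C m) (m * ((2 * m) C m)) ⟩
      suc m * ((2 * m) C suc m) + m * ((2 * m) C m) + (2 * m) C m
        ≡⟨ cong (_+ ((2 * m) C m)) ([k+1]*nC[k+1] (2 * m) m) ⟩
      2 * m * ((2 * m) C m) + (2 * m) C m
        ≡⟨ solve 2 (λ m a → con 2 :* m :* a :+ a := (con 1 :+ m) :* a :+ m :* a) refl m ((2 * m) C m) ⟩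
      suc m * ((2 * m) C m) + m * ((2 * m) C m) ∎)

  [m+1]*catalan : ∀ m → suc m * catalan m ≡ (2 * m) C m
  [m+1]*catalan m = ℕ.m*[n/m]≡n ([m+1]∣2mCm m)

  catalan-rec : ∀ m → suc (suc m) * catalan (suc m) ≡ 2 * suc (2 * m) * catalan m
  catalan-rec m = ℕ.*-cancelˡ-≡ _ _ (suc m) (begin
    suc m * (suc (suc m) * catalan (suc m))
      ≡⟨ cong (suc m *_) ([m+1]*catalan (suc m)) ⟩
    suc m * ((2 * suc m) C suc m)
      ≡⟨ cong (λ t → suc m * (t C suc m)) 2[m+1] ⟩
    suc m * (suc (suc (2 * m)) C suc m)
      ≡⟨ [k+1]*[n+1]C[k+1] (suc (2 * m)) m ⟩
    suc (suc (2 * m)) * (suc (2 * m) C m)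
      ≡⟨ cong₂ _*_ (sym 2[m+1]) symmetric ⟩
    2 * suc m * (suc (2 * m) C suc m)
      ≡⟨ ℕ.*-assoc 2 (suc m) _ ⟩
    2 * (suc m * (suc (2 * m) C suc m))
      ≡⟨ cong (2 *_) ([k+1]*[n+1]C[k+1] (2 * m) m) ⟩
    2 * (suc (2 * m) * ((2 * m) C m))
      ≡⟨ cong (λ t → 2 * (suc (2 * m) * t)) ([m+1]*catalan m) ⟨
    2 * (suc (2 * m) * (suc m * catalan m))
      ≡⟨ solve 3 (λ a b c → con 2 :* (a :* (b :* c)) := b :* (con 2 :* a :* c)) refl (suc (2 * m)) (suc m) (catalan m) ⟩
    suc m * (2 * suc (2 * m) * catalan m) ∎)
    where
    2[m+1] : 2 * suc m ≡ suc (suc (2 * m))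
    2[m+1] = cong suc (ℕ.+-suc m (m + 0))
    symmetric : suc (2 * m) C m ≡ suc (2 * m) C suc m
    symmetric = trans (nCk≡nC[n∸k] (ℕ.m≤n⇒m≤1+n (ℕ.m≤m+n m (m + 0))))
      (cong (suc (2 * m) C_) (trans (cong (_∸ m) (solve 1 (λ m → con 1 :+ con 2 :* m := con 1 :+ m :+ m) refl m))
                                    (ℕ.m+n∸n≡m (suc m) m)))

  -- `catalan-rec` prepared for a comparison of coefficients: `m * catalan m` is a coefficient of
  -- the Euler derivative, and the numerals 4 and 2 are spelled out as sums so that `fromℕ` can be
  -- pushed through.
  catalan-ode : ∀ m → let d = m * catalan m ; c = catalan m in
    suc m * catalan (suc m) + catalan (suc m) ≡ d + d + d + d + (c + c)
  catalan-ode m = begin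
    suc m * catalan (suc m) + catalan (suc m)
      ≡⟨ ℕ.+-comm (suc m * catalan (suc m)) _ ⟩
    suc (suc m) * catalan (suc m)
      ≡⟨ catalan-rec m ⟩
    2 * suc (2 * m) * catalan m
      ≡⟨ solve 2 (λ m c → let d = m :* c in
           con 2 :* (con 1 :+ con 2 :* m) :* c := d :+ d :+ d :+ d :+ (c :+ c)) refl m (catalan m) ⟩
    _ ∎

-- The quadratic equation of the Catalan series.

module CatalanSeries {c ℓ : Level} (R : CommutativeRing c ℓ) where
  open CommutativeRing R
  open Series R
  open PowerSeries R
  open SetoidReasoning setoid
  private
    module SR = CommutativeRing seriesRing
    module S = NaturalCoefficients commutativeSemiring
    module P = NaturalCoefficients SR.commutativeSemiring
    module ≋-Reasoning = SetoidReasoning SR.setoid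
  open GroupProperties +-group using () renaming (∙-cancelʳ to +-cancelʳ)

  fromℕ-cong : ∀ {m n} → m ≡ n → fromℕ m ≈ fromℕ n
  fromℕ-cong ≡.refl = refl

  fromℕ-+ : ∀ m n → fromℕ (m ℕ.+ n) ≈ fromℕ m + fromℕ n
  fromℕ-+ zero    n = sym (+-identityˡ _)
  fromℕ-+ (suc m) n = trans (+-congˡ (fromℕ-+ m n)) (sym (+-assoc _ _ _))

  fromℕ-* : ∀ m n → fromℕ (m ℕ.* n) ≈ fromℕ m * fromℕ n
  fromℕ-* zero    n = sym (zeroˡ _)
  fromℕ-* (suc m) n = trans (fromℕ-+ n (m ℕ.* n)) (trans (+-cong (sym (*-identityˡ _)) (fromℕ-* m n))
    (sym (distribʳ _ _ _)))

  fromℕ-1 : fromℕ 1 ≈ 1#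
  fromℕ-1 = +-identityʳ _

  catSer : Ser
  catSer n = fromℕ (catalan n)

  -- The Euler operator `x d/dx`, a derivation that does not shift indices.
  θ : Ser → Ser
  θ f n = fromℕ n * f n

  θ-· : ∀ f g → θ (f · g) ≋ ((θ f · g) +ˢ (f · θ g))
  θ-· f g n = begin
    fromℕ n * (f · g) n
      ≈⟨ sumTo-*ˡ n (fromℕ n) _ ⟨
    sumTo n (λ i → fromℕ n * (f i * g (n ∸ i)))
      ≈⟨ sumTo-cong n (λ i i≤n → trans
           (*-congʳ (trans (fromℕ-cong (≡.sym (ℕ.m+[n∸m]≡n i≤n))) (fromℕ-+ i (n ∸ i))))
           (S.solve 4 (λ a b x y → (a S.:+ b) S.:* (x S.:* y) S.:= a S.:* x S.:* y S.:+ x S.:* (b S.:* y)) refl _ _ _ _)) ⟩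
    sumTo n (λ i → fromℕ i * f i * g (n ∸ i) + f i * (fromℕ (n ∸ i) * g (n ∸ i)))
      ≈⟨ sumTo-+ n _ _ ⟩
    ((θ f · g) +ˢ (f · θ g)) n ∎

  θX : θ X ≋ X
  θX zero          = zeroˡ _
  θX (suc zero)    = trans (*-identityʳ _) fromℕ-1
  θX (suc (suc n)) = zeroʳ _

  θone : θ one ≋ 0ˢ
  θone zero    = zeroˡ _
  θone (suc n) = zeroʳ _

  -- The recurrence (m + 2) C (m + 1) = 2 (2m + 1) C m is a differential equation for c = catSer.
  -- With p = 1 + x c² it gives (1 - 4x) θ (p - c) = - (p - c), which forces p = c when the positive
  -- integers can be cancelled.
  private
    d p : Ser
    d = θ catSer
    p = one +ˢ (X · (catSer · catSer))

  catSer-ode : (d +ˢ catSer) ≋ (one +ˢ (X · ((((d +ˢ d) +ˢ d) +ˢ d) +ˢ (catSer +ˢ catSer))))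
  catSer-ode zero    = trans (+-cong (zeroˡ _) fromℕ-1)
    (trans (+-comm _ _) (+-congˡ (sym (X·-zero ((((d +ˢ d) +ˢ d) +ˢ d) +ˢ (catSer +ˢ catSer))))))
  catSer-ode (suc n) = begin
    fromℕ (suc n) * c′ + c′
      ≈⟨ +-congʳ (fromℕ-* (suc n) (catalan (suc n))) ⟨
    fromℕ (suc n ℕ.* catalan (suc n)) + c′
      ≈⟨ fromℕ-+ (suc n ℕ.* catalan (suc n)) (catalan (suc n)) ⟨
    fromℕ (suc n ℕ.* catalan (suc n) ℕ.+ catalan (suc n))
      ≈⟨ fromℕ-cong (CatalanNumbers.catalan-ode n) ⟩
    fromℕ (dₙ ℕ.+ dₙ ℕ.+ dₙ ℕ.+ dₙ ℕ.+ (cₙ ℕ.+ cₙ))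
      ≈⟨ trans (fromℕ-+ (dₙ ℕ.+ dₙ ℕ.+ dₙ ℕ.+ dₙ) _) (+-cong
           (trans (fromℕ-+ (dₙ ℕ.+ dₙ ℕ.+ dₙ) _) (+-cong
             (trans (fromℕ-+ (dₙ ℕ.+ dₙ) _) (+-cong (trans (fromℕ-+ dₙ dₙ) (+-cong e e)) e)) e))
           (fromℕ-+ cₙ cₙ)) ⟩
    d n + d n + d n + d n + (catSer n + catSer n)
      ≈⟨ X·-suc ((((d +ˢ d) +ˢ d) +ˢ d) +ˢ (catSer +ˢ catSer)) n ⟨
    (X · ((((d +ˢ d) +ˢ d) +ˢ d) +ˢ (catSer +ˢ catSer))) (suc n)
      ≈⟨ +-identityˡ _ ⟨
    _ ∎
    where
    c′ = catSer (suc n)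
    cₙ = catalan n
    dₙ = n ℕ.* catalan n
    e : fromℕ dₙ ≈ d n
    e = fromℕ-* n (catalan n)

  θp : θ p ≋ ((X · (catSer · catSer)) +ˢ (X · ((d · catSer) +ˢ (catSer · d))))
  θp n = begin
    fromℕ n * (one n + (X · (catSer · catSer)) n)
      ≈⟨ distribˡ _ _ _ ⟩
    θ one n + θ (X · (catSer · catSer)) n
      ≈⟨ +-cong (θone n) (θ-· X (catSer · catSer) n) ⟩
    0# + ((θ X · (catSer · catSer)) n + (X · θ (catSer · catSer)) n)
      ≈⟨ +-identityˡ _ ⟩
    (θ X · (catSer · catSer)) n + (X · θ (catSer · catSer)) n
      ≈⟨ +-cong (·-cong {g = catSer · catSer} θX ≋-refl n) (·-cong {f = X} ≋-refl (θ-· catSer catSer) n) ⟩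
    _ ∎

  -- Every term stands on the side where its sign is positive, since the solver works over
  -- semirings. `θ p` and `p` together produce `2xc(d + c)`, and `catSer-ode` replaces that factor
  -- `d + c`.
  p-ode : ((θ p +ˢ (X · (((d +ˢ d) +ˢ d) +ˢ d))) +ˢ p) ≋
          ((d +ˢ (X · (((θ p +ˢ θ p) +ˢ θ p) +ˢ θ p))) +ˢ catSer)
  p-ode = let module E = ≋-Reasoning in E.begin
    (θ p +ˢ (X · (((d +ˢ d) +ˢ d) +ˢ d))) +ˢ p
      E.≈⟨ (λ n → +-congʳ (+-congʳ (θp n))) ⟩
    (θp′ +ˢ (X · (((d +ˢ d) +ˢ d) +ˢ d))) +ˢ p
      E.≈⟨ P.solve 3 (λ x c d →
             x P.:* (c P.:* c) P.:+ x P.:* (d P.:* c P.:+ c P.:* d) P.:+ x P.:* (d P.:+ d P.:+ d P.:+ d)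
               P.:+ (P.con 1 P.:+ x P.:* (c P.:* c))
             P.:= P.con 1 P.:+ x P.:* (d P.:+ d P.:+ d P.:+ d) P.:+ P.con 2 P.:* x P.:* c P.:* (d P.:+ c))
             ≋-refl X catSer d ⟩
    (one +ˢ (X · (((d +ˢ d) +ˢ d) +ˢ d))) +ˢ (((two · X) · catSer) · (d +ˢ catSer))
      E.≈⟨ (λ n → +-congˡ (·-cong {f = (two · X) · catSer} ≋-refl catSer-ode n)) ⟩
    (one +ˢ (X · (((d +ˢ d) +ˢ d) +ˢ d))) +ˢ (((two · X) · catSer) · rhs)
      E.≈⟨ P.solve 3 (λ x c d →
             P.con 1 P.:+ x P.:* (d P.:+ d P.:+ d P.:+ d) P.:+ P.con 2 P.:* x P.:* c P.:*
               (P.con 1 P.:+ x P.:* (d P.:+ d P.:+ d P.:+ d P.:+ (c P.:+ c)))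
             P.:= (let t = x P.:* (c P.:* c) P.:+ x P.:* (d P.:* c P.:+ c P.:* d) in
               P.con 1 P.:+ x P.:* (d P.:+ d P.:+ d P.:+ d P.:+ (c P.:+ c)) P.:+ x P.:* (t P.:+ t P.:+ t P.:+ t)))
             ≋-refl X catSer d ⟩
    rhs +ˢ (X · (((θp′ +ˢ θp′) +ˢ θp′) +ˢ θp′))
      E.≈⟨ (λ n → +-cong (catSer-ode n) (·-cong {f = X} ≋-refl
              (λ i → +-cong (+-cong (+-cong (θp i) (θp i)) (θp i)) (θp i)) n)) ⟨
    (d +ˢ catSer) +ˢ (X · (((θ p +ˢ θ p) +ˢ θ p) +ˢ θ p))
      E.≈⟨ (λ n → S.solve 3 (λ a b c → a S.:+ b S.:+ c S.:= a S.:+ c S.:+ b) refl _ _ _) ⟩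
    (d +ˢ (X · (((θ p +ˢ θ p) +ˢ θ p) +ˢ θ p))) +ˢ catSer E.∎
    where
    θp′ = (X · (catSer · catSer)) +ˢ (X · ((d · catSer) +ˢ (catSer · d)))
    rhs = one +ˢ (X · ((((d +ˢ d) +ˢ d) +ˢ d) +ˢ (catSer +ˢ catSer)))
    two = one +ˢ one

  TorsionFree : Set _
  TorsionFree = ∀ n x y → fromℕ (suc n) * x ≈ fromℕ (suc n) * y → x ≈ y

  catSer-quadratic : TorsionFree → catSer ≋ (one +ˢ (X · (catSer · catSer)))
  catSer-quadratic tf zero    = trans fromℕ-1 (sym (trans (+-congˡ (X·-zero (catSer · catSer))) (+-identityʳ _)))
  catSer-quadratic tf (suc n) = sym (tf (suc n) _ _ (trans (lem _ _) (trans (+-cancelʳ t _ _ eq) (sym (lem _ _)))))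
    where
    4d = ((d +ˢ d) +ˢ d) +ˢ d
    4θp = ((θ p +ˢ θ p) +ˢ θ p) +ˢ θ p
    t = 4d n
    lem : ∀ a b → (1# + a) * b ≈ a * b + b
    lem a b = trans (distribʳ _ _ _) (trans (+-comm _ _) (+-congˡ (*-identityˡ _)))
    ih : θ p n ≈ d n
    ih = *-congˡ (sym (catSer-quadratic tf n))
    -- Terms with a factor `X` involve only coefficient `n`, where `p` and `catSer` agree by `ih`.
    -- Cancelling them leaves `(n + 2) p = (n + 2) c` at index `n + 1`.
    eq : θ p (suc n) + p (suc n) + t ≈ d (suc n) + catSer (suc n) + t
    eq = begin
      θ p (suc n) + p (suc n) + t
        ≈⟨ S.solve 3 (λ a b c → a S.:+ b S.:+ c S.:= a S.:+ c S.:+ b) refl _ _ _ ⟩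
      θ p (suc n) + t + p (suc n)
        ≈⟨ +-congʳ (+-congˡ (X·-suc 4d n)) ⟨
      θ p (suc n) + (X · 4d) (suc n) + p (suc n)
        ≈⟨ p-ode (suc n) ⟩
      d (suc n) + (X · 4θp) (suc n) + catSer (suc n)
        ≈⟨ +-congʳ (+-congˡ (trans (X·-suc 4θp n) (+-cong (+-cong (+-cong ih ih) ih) ih))) ⟩
      d (suc n) + t + catSer (suc n)
        ≈⟨ S.solve 3 (λ a b c → a S.:+ b S.:+ c S.:= a S.:+ c S.:+ b) refl _ _ _ ⟩
      _ ∎

sumToℕ : ℕ → (ℕ → ℕ) → ℕ
sumToℕ zero    f = f zero
sumToℕ (suc n) f = sumToℕ n f ℕ.+ f (suc n)

-- Proved in ℤ[[x]], where positive integers can be cancelled, and transported to any ring by fromℕ.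
catalan-convolution : ∀ n → catalan (suc n) ≡ sumToℕ n (λ i → catalan i ℕ.* catalan (n ∸ i))
catalan-convolution n = ℤ.+-injective (begin
  pos (catalan (suc n))
    ≡⟨ fromℕ≡+ (catalan (suc n)) ⟨
  catSer (suc n)
    ≡⟨ catSer-quadratic (λ k x y e → ℤ.*-cancelˡ-≡ (pos (suc k)) x y
         (≡.trans (≡.cong (ℤ._* x) (≡.sym (fromℕ≡+ (suc k)))) (≡.trans e (≡.cong (ℤ._* y) (fromℕ≡+ (suc k))))))
         (suc n) ⟩
  pos 0 ℤ.+ (X · (catSer · catSer)) (suc n)
    ≡⟨ ℤ.+-identityˡ _ ⟩
  (X · (catSer · catSer)) (suc n)
    ≡⟨ X·-suc (catSer · catSer) n ⟩
  (catSer · catSer) n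
    ≡⟨ sumTo-cong n (λ i _ → ≡.trans (≡.sym (fromℕ-* (catalan i) (catalan (n ∸ i)))) (fromℕ≡+ _)) ⟩
  sumTo n (λ i → pos (catalan i ℕ.* catalan (n ∸ i)))
    ≡⟨ sumTo-+ℕ n ⟩
  pos (sumToℕ n (λ i → catalan i ℕ.* catalan (n ∸ i))) ∎)
  where
  open ≡.≡-Reasoning
  open Series ℤ.+-*-commutativeRing
  open PowerSeries ℤ.+-*-commutativeRing
  open CatalanSeries ℤ.+-*-commutativeRing
  fromℕ≡+ : ∀ n → fromℕ n ≡ pos n
  fromℕ≡+ zero    = ≡.refl
  fromℕ≡+ (suc n) = ≡.cong (ℤ._+_ (pos 1)) (fromℕ≡+ n)
  sumTo-+ℕ : ∀ n {f} → sumTo n (λ i → pos (f i)) ≡ pos (sumToℕ n f)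
  sumTo-+ℕ zero    = ≡.refl
  sumTo-+ℕ (suc n) {f} = ≡.trans (≡.cong (ℤ._+ pos (f (suc n))) (sumTo-+ℕ n)) (≡.sym (ℤ.pos-+ (sumToℕ n f) (f (suc n))))

module CatalanSeriesSquare {c ℓ : Level} (R : CommutativeRing c ℓ) where
  open CommutativeRing R
  open Series R
  open PowerSeries R
  open CatalanSeries R

  fromℕ-sumToℕ : ∀ n f → fromℕ (sumToℕ n f) ≈ sumTo n (λ i → fromℕ (f i))
  fromℕ-sumToℕ zero    f = refl
  fromℕ-sumToℕ (suc n) f = trans (fromℕ-+ (sumToℕ n f) _) (+-congʳ (fromℕ-sumToℕ n f))

  tail-catSer : tail catSer ≋ (catSer · catSer)
  tail-catSer n = trans (fromℕ-cong (catalan-convolution n)) (trans (fromℕ-sumToℕ n _)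
    (sumTo-cong n (λ i _ → fromℕ-* (catalan i) (catalan (n ∸ i)))))

-- Generating functions of the completions of a partition.

module TransferSeries {c ℓ : Level} (R : CommutativeRing c ℓ) (w : ℕ → CommutativeRing.Carrier R) where
  open CommutativeRing R
  open Series R
  open PowerSeries R
  open CatalanSeries R
  open CatalanSeriesSquare R
  private
    module SR = CommutativeRing seriesRing
    module P = NaturalCoefficients SR.commutativeSemiring
    module ≋-Reasoning = SetoidReasoning SR.setoid

  -- Coefficient `r` is the weight of a block that grows from `s` to `s + r + 1` elements. After
  -- composition with `X · D`, each of the last `r` elements brings along the gap in front of it.
  after : ℕ → Ser
  after s r = w (suc (r ℕ.+ s))

  Φ : Ser → Ser
  Φ u = one +ˢ (X · (u · (u · (after 0 ∘ˢ (X · u)))))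

  Φ-contraction : Contraction Φ
  Φ-contraction n u v e = +-cong-[] {f = one} (λ _ _ → refl) (·-contractive n refl
    (·-cong-[] n e (·-cong-[] n e (∘-congʳ-[] (after 0) n
      (λ i i<n → ·-contractive {X} n refl e i (ℕ.m≤n⇒m≤1+n i<n))))))

  -- D, V s, K i enumerate the completions of, respectively: nothing; a block that already has
  -- s elements and will receive at least one more; a chain that already has i blocks.
  D : Ser
  D = fix Φ

  D-unfold : D ≋ Φ D
  D-unfold = fix-unfold Φ-contraction

  XD0 : (X · D) 0 ≈ 0#
  XD0 = X·-zero D

  V : ℕ → Ser
  V s = X · (after s ∘ˢ (X · D))

  V0 : ∀ s → V s 0 ≈ 0#
  V0 s = X·-zero (after s ∘ˢ (X · D))

  K : ℕ → Ser
  K i = (λ r → catSer (r ℕ.+ i)) ∘ˢ V 0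

  -- Having received an element, the block is either complete or leaves a gap, filled by `D`, before
  -- growing again.
  V-unfold : ∀ s → V s ≋ (X · (const (w (suc s)) +ˢ (D · V (suc s))))
  V-unfold s = ·-cong {f = X} ≋-refl (E.begin
    after s ∘ˢ (X · D)
      E.≈⟨ ∘-unfold (after s) XD0 ⟩
    const (w (suc s)) +ˢ ((X · D) · (tail (after s) ∘ˢ (X · D)))
      E.≈⟨ (λ n → +-congˡ (·-cong {f = X · D} ≋-refl (∘-cong {h = X · D} (λ r →
             reflexive (≡.cong (λ m → w (suc m)) (≡.sym (ℕ.+-suc r s)))) ≋-refl) n)) ⟩
    const (w (suc s)) +ˢ ((X · D) · (after (suc s) ∘ˢ (X · D)))
      E.≈⟨ P.solve 4 (λ a x d f → a P.:+ x P.:* d P.:* f P.:= a P.:+ d P.:* (x P.:* f)) ≋-refl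
             (const (w (suc s))) X D (after (suc s) ∘ˢ (X · D)) ⟩
    const (w (suc s)) +ˢ (D · V (suc s)) E.∎)
    where module E = ≋-Reasoning

  K-unfold : ∀ i → K i ≋ (const (catSer i) +ˢ (V 0 · K (suc i)))
  K-unfold i n = trans (∘-unfold (λ r → catSer (r ℕ.+ i)) (V0 0) n)
    (+-congˡ (·-cong {f = V 0} ≋-refl (∘-cong {h = V 0} (λ r →
      fromℕ-cong (≡.cong catalan (≡.sym (ℕ.+-suc r i)))) ≋-refl) n))

  -- The Catalan convolution says that shifting the index squares the Catalan series, and
  -- composition with `V 0` is multiplicative.
  K1≋K0² : K 1 ≋ (K 0 · K 0)
  K1≋K0² = E.begin
    K 1
      E.≈⟨ ∘-cong {h = V 0} (λ r → trans (fromℕ-cong (≡.cong catalan (ℕ.+-comm r 1))) (tail-catSer r)) ≋-refl ⟩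
    (catSer · catSer) ∘ˢ V 0
      E.≈⟨ ∘-· catSer catSer (V0 0) ⟩
    (catSer ∘ˢ V 0) · (catSer ∘ˢ V 0)
      E.≈⟨ ·-cong e e ⟩
    K 0 · K 0 E.∎
    where
    module E = ≋-Reasoning
    e : (catSer ∘ˢ V 0) ≋ K 0
    e = ∘-cong {h = V 0} (λ r → fromℕ-cong (≡.cong catalan (≡.sym (ℕ.+-identityʳ r)))) ≋-refl

  -- Both are solutions of `u = 1 + V 0 · u²`. Although `V 0` was built from `D`, it is held
  -- constant here, so that the right-hand side is a contraction in `u`.
  K0≋D : K 0 ≋ D
  K0≋D = fix-unique Ψ-contraction
    (λ n → trans (K-unfold 0 n) (+-cong (trans (const-cong fromℕ-1 n) (const-1 n)) (·-cong {f = V 0} ≋-refl K1≋K0² n)))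
    (≋-trans D-unfold (P.solve 3 (λ x d f →
      P.con 1 P.:+ x P.:* (d P.:* (d P.:* f)) P.:= P.con 1 P.:+ x P.:* f P.:* (d P.:* d)) ≋-refl
      X D (after 0 ∘ˢ (X · D))))
    where
    Ψ : Ser → Ser
    Ψ u = one +ˢ (V 0 · (u · u))
    Ψ-contraction : Contraction Ψ
    Ψ-contraction n u v e = +-cong-[] {f = one} (λ _ _ → refl) (·-contractive {V 0} n (V0 0) (·-cong-[] n e e))

  Family : Set c
  Family = ℕ → Ser

  -- A family z counts by z i the completions when i further finished outer blocks stand to the left.
  -- A block of size s put before them either grows no more, or grows and closes everything on its right.
  Step : ℕ → Family → Family
  Step s z i = (const (w s) · z (suc i)) +ˢ ((z 0 · V s) · K (suc i))

  run : Family → List ℕ → Family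
  run z []      = z
  run z (s ∷ S) = run (Step s z) S

  -- Z S enumerates the completions of a noncrossing partition whose outer blocks have,
  -- from right to left, the sizes S.
  Z : List ℕ → Ser
  Z S = run K S 0

  weight : List ℕ → Carrier
  weight []      = 1#
  weight (s ∷ S) = w s * weight S

  -- The next element joins one of the outer blocks S, and closes the chain of the k blocks
  -- of total weight p on its right.
  joins : ℕ → Ser → List ℕ → Ser
  joins k p []      = 0ˢ
  joins k p (s ∷ S) = (const (catSer k) · (p · Z (suc s ∷ S))) +ˢ joins (suc k) (p · const (w s)) S

  run-cong : ∀ {y z} → (∀ i → y i ≋ z i) → ∀ S → ∀ i → run y S i ≋ run z S i
  run-cong e []      = e
  run-cong e (s ∷ S) = run-cong (λ i n → +-cong
    (·-cong {f = const (w s)} ≋-refl (e (suc i)) n)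
    (·-cong {g = K (suc i)} (·-cong {g = V s} (e 0) ≋-refl) ≋-refl n)) S

  -- Used in `run-unfold` to split off, at each block, the case where the next element joins exactly
  -- that block.
  run-linear : ∀ r y z S i → run (λ j → y j +ˢ (r · z j)) S i ≋ (run y S i +ˢ (r · run z S i))
  run-linear r y z []      i = ≋-refl
  run-linear r y z (s ∷ S) i = ≋-trans
    (run-cong (λ j → P.solve 8 (λ r ws y₁ z₁ y₀ z₀ v k →
       ws P.:* (y₁ P.:+ r P.:* z₁) P.:+ (y₀ P.:+ r P.:* z₀) P.:* v P.:* k P.:=
       ws P.:* y₁ P.:+ y₀ P.:* v P.:* k P.:+ r P.:* (ws P.:* z₁ P.:+ z₀ P.:* v P.:* k)) ≋-refl
       r (const (w s)) (y (suc j)) (z (suc j)) (y 0) (z 0) (V s) (K (suc j))) S i)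
    (run-linear r (Step s y) (Step s z) S i)

  -- A block of size `s` that grows receives one element and is then a block of size `s + 1` with
  -- nothing on its right. The gap that may follow is `D` in `V-unfold` but `K 0` in `Step`, so
  -- `K0≋D` is the crux.
  V·K : ∀ s i → (V s · K (suc i)) ≋ (X · Step (suc s) K i)
  V·K s i = E.begin
    V s · K (suc i)
      E.≈⟨ ·-cong {g = K (suc i)} (V-unfold s) ≋-refl ⟩
    (X · (const (w (suc s)) +ˢ (D · V (suc s)))) · K (suc i)
      E.≈⟨ ·-cong {g = K (suc i)} (·-cong {f = X} {g = const (w (suc s)) +ˢ (K 0 · V (suc s))} ≋-refl (λ n → +-congˡ (·-cong {g = V (suc s)} K0≋D ≋-refl n))) ≋-refl ⟨
    (X · (const (w (suc s)) +ˢ (K 0 · V (suc s)))) · K (suc i)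
      E.≈⟨ P.solve 5 (λ x a d v k → x P.:* (a P.:+ d P.:* v) P.:* k P.:= x P.:* (a P.:* k P.:+ d P.:* v P.:* k)) ≋-refl
             X (const (w (suc s))) (K 0) (V (suc s)) (K (suc i)) ⟩
    X · Step (suc s) K i E.∎
    where module E = ≋-Reasoning

  -- p is the weight of k outer blocks already read; z i splits into the case where no element follows
  -- and the case y i where the next element is new or belongs to one of these k blocks.
  run-unfold : ∀ S k p y z → (∀ i → z i ≋ ((const (catSer (k ℕ.+ i)) · p) +ˢ (X · y i))) →
    run z S 0 ≋ ((const (catSer (k ℕ.+ length S)) · (p · const (weight S))) +ˢ (X · (run y S 0 +ˢ joins k p S)))
  run-unfold []      k p y z e = E.begin
    z 0
      E.≈⟨ e 0 ⟩
    (const (catSer (k ℕ.+ 0)) · p) +ˢ (X · y 0)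
      E.≈⟨ P.solve 4 (λ a p x y → a P.:* p P.:+ x P.:* y P.:=
             a P.:* (p P.:* P.con 1) P.:+ x P.:* (y P.:+ P.con 0)) ≋-refl (const (catSer (k ℕ.+ 0))) p X (y 0) ⟩
    (const (catSer (k ℕ.+ 0)) · (p · one)) +ˢ (X · (y 0 +ˢ 0ˢ))
      E.≈⟨ (λ n → +-congʳ (·-cong {f = const (catSer (k ℕ.+ 0))} ≋-refl (·-cong {f = p} ≋-refl const-1) n)) ⟨
    (const (catSer (k ℕ.+ 0)) · (p · const 1#)) +ˢ (X · (y 0 +ˢ 0ˢ)) E.∎
    where module E = ≋-Reasoning
  run-unfold (s ∷ S) k p y z e = E.begin
    run (Step s z) S 0
      E.≈⟨ run-unfold S (suc k) (p · const (w s)) y′ (Step s z) invariant ⟩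
    (const (catSer (suc k ℕ.+ length S)) · ((p · const (w s)) · const (weight S)))
      +ˢ (X · (run y′ S 0 +ˢ joins (suc k) (p · const (w s)) S))
      E.≈⟨ (λ n → +-cong
             (·-cong (const-cong (fromℕ-cong (≡.cong catalan (≡.sym (ℕ.+-suc k (length S))))))
               (≋-trans (·-assoc p (const (w s)) (const (weight S)))
                        (·-cong {f = p} ≋-refl (≋-sym (const-* (w s) (weight S))))) n)
             (·-cong {f = X} {g = run y′ S 0 +ˢ joins (suc k) (p · const (w s)) S} ≋-refl (λ m → +-congʳ (run-linear r (Step s y) (Step (suc s) K) S 0 m)) n)) ⟩
    (const (catSer (k ℕ.+ suc (length S))) · (p · const (w s * weight S)))
      +ˢ (X · ((run (Step s y) S 0 +ˢ (r · Z (suc s ∷ S))) +ˢ joins (suc k) (p · const (w s)) S))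
      E.≈⟨ (λ n → +-congˡ (·-cong {f = X} ≋-refl (P.solve 5 (λ a c p b d →
             a P.:+ c P.:* p P.:* b P.:+ d P.:= a P.:+ (c P.:* (p P.:* b) P.:+ d)) ≋-refl
             (run (Step s y) S 0) (const (catSer k)) p (Z (suc s ∷ S)) (joins (suc k) (p · const (w s)) S)) n)) ⟩
    _ E.∎
    where
    module E = ≋-Reasoning
    r  = const (catSer k) · p
    -- `Step s y` keeps the next element among the cases already counted by `y`. In the other
    -- summand it joins the block of size `s`, and `r` is the settled contribution of the `k` blocks
    -- on the right.
    y′ : Family
    y′ i = Step s y i +ˢ (r · Step (suc s) K i)
    invariant : ∀ i → Step s z i ≋ ((const (catSer (suc k ℕ.+ i)) · (p · const (w s))) +ˢ (X · y′ i))
    invariant i = E.begin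
      (const (w s) · z (suc i)) +ˢ ((z 0 · V s) · K (suc i))
        E.≈⟨ (λ n → +-cong (·-cong {f = const (w s)} ≋-refl (e (suc i)) n)
               (·-cong {g = K (suc i)} (·-cong {g = V s} (e 0) ≋-refl) ≋-refl n)) ⟩
      (const (w s) · ((const (catSer (k ℕ.+ suc i)) · p) +ˢ (X · y (suc i))))
        +ˢ ((((const (catSer (k ℕ.+ 0)) · p) +ˢ (X · y 0)) · V s) · K (suc i))
        E.≈⟨ (λ n → +-cong
               (·-cong {f = const (w s)} {g = (const (catSer (k ℕ.+ suc i)) · p) +ˢ (X · y (suc i))} ≋-refl (λ m → +-congʳ (·-cong {g = p}
                 (const-cong (fromℕ-cong (≡.cong catalan (ℕ.+-suc k i)))) ≋-refl m)) n)
               (·-cong {g = K (suc i)} (·-cong {g = V s} (λ m → +-congʳ (·-cong {g = p}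
                 (const-cong (fromℕ-cong (≡.cong catalan (ℕ.+-identityʳ k)))) ≋-refl m)) ≋-refl) ≋-refl n)) ⟩
      (const (w s) · ((const (catSer (suc k ℕ.+ i)) · p) +ˢ (X · y (suc i))))
        +ˢ (((r +ˢ (X · y 0)) · V s) · K (suc i))
        E.≈⟨ P.solve 9 (λ ws c p x y₁ r y₀ v k →
               ws P.:* (c P.:* p P.:+ x P.:* y₁) P.:+ (r P.:+ x P.:* y₀) P.:* v P.:* k P.:=
               (c P.:* (p P.:* ws) P.:+ x P.:* (ws P.:* y₁ P.:+ y₀ P.:* v P.:* k)) P.:+ r P.:* (v P.:* k)) ≋-refl
               (const (w s)) (const (catSer (suc k ℕ.+ i))) p X (y (suc i)) r (y 0) (V s) (K (suc i)) ⟩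
      ((const (catSer (suc k ℕ.+ i)) · (p · const (w s))) +ˢ (X · Step s y i)) +ˢ (r · (V s · K (suc i)))
        E.≈⟨ (λ n → +-congˡ (·-cong {f = r} ≋-refl (V·K s i) n)) ⟩
      ((const (catSer (suc k ℕ.+ i)) · (p · const (w s))) +ˢ (X · Step s y i)) +ˢ (r · (X · Step (suc s) K i))
        E.≈⟨ P.solve 5 (λ a x b r d → a P.:+ x P.:* b P.:+ r P.:* (x P.:* d) P.:= a P.:+ x P.:* (b P.:+ r P.:* d)) ≋-refl
               (const (catSer (suc k ℕ.+ i)) · (p · const (w s))) X (Step s y i) r (Step (suc s) K i) ⟩
      _ E.∎

  Z-unfold : ∀ S → Z S ≋ ((const (catSer (length S)) · const (weight S)) +ˢ (X · (Z (1 ∷ S) +ˢ joins 0 one S)))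
  Z-unfold S = ≋-trans (run-unfold S 0 one (Step 1 K) K initial)
    (λ n → +-congʳ (·-cong {f = const (catSer (length S))} ≋-refl (one-· (const (weight S))) n))
    where
    -- A new block is a block of size 0 that receives its first element: `V·K` at `s = 0`.
    initial : ∀ i → K i ≋ ((const (catSer i) · one) +ˢ (X · Step 1 K i))
    initial i n = trans (K-unfold i n) (+-cong (sym (·-one (const (catSer i)) n)) (V·K 0 i n))

  Z[]≋D : Z [] ≋ D
  Z[]≋D = K0≋D

  Z-zero : ∀ S → Z S 0 ≈ catSer (length S) * weight S
  Z-zero S = trans (Z-unfold S 0) (trans (+-cong
    (*-cong (*-identityʳ _) (*-identityʳ _)) (X·-zero (Z (1 ∷ S) +ˢ joins 0 one S))) (+-identityʳ _))

  Z-suc : ∀ S n → Z S (suc n) ≈ Z (1 ∷ S) n + joins 0 one S n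
  Z-suc S n = trans (Z-unfold S (suc n)) (trans (+-cong
    (trans (const-· (catSer (length S)) (const (weight S)) (suc n)) (trans (*-congˡ (zeroʳ _)) (zeroʳ _)))
    (X·-suc (Z (1 ∷ S) +ˢ joins 0 one S) n)) (+-identityˡ _))

-- The compositional inverse as `x D`.

module CompositionalInverse {c ℓ : Level} (R : CommutativeRing c ℓ) where
  open CommutativeRing R
  open Series R
  open PowerSeries R
  private
    module SR = CommutativeRing seriesRing
    module P = NaturalCoefficients SR.commutativeSemiring
    module ≋-Reasoning = SetoidReasoning SR.setoid

  inverse : (ℕ → Carrier) → Ser
  inverse a = X · TransferSeries.D R (λ s → - a s)

  inverse-zero : ∀ a → inverse a 0 ≈ 0#
  inverse-zero a = TransferSeries.XD0 R (λ s → - a s)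

  -- Writing `h = x D`, the left side is `x D + x² D² a⁺(h)`. Unfolding the linear `D` once gives
  -- `x - x² D² a⁺(h)` for the first term, because the weights are `- a`.
  shiftSer∘inverse : ∀ a → (shiftSer a ∘ˢ inverse a) ≋ X
  shiftSer∘inverse a = E.begin
    shiftSer a ∘ˢ h
      E.≈⟨ ∘-unfold (shiftSer a) h0 ⟩
    const 0# +ˢ (h · (tail (shiftSer a) ∘ˢ h))
      E.≈⟨ (λ n → trans (+-cong (const-0 n) (·-cong {f = h} ≋-refl (∘-unfold (tail (shiftSer a)) h0) n)) (+-identityˡ _)) ⟩
    h · (const 1# +ˢ (h · (tail (tail (shiftSer a)) ∘ˢ h)))
      E.≈⟨ ·-cong {f = h} ≋-refl (λ n → +-cong (const-1 n) (·-cong {f = h} ≋-refl (∘-cong {h = h} a⁺ ≋-refl) n)) ⟩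
    h · (one +ˢ (h · ((λ r → a (suc r)) ∘ˢ h)))
      E.≈⟨ P.solve 3 (λ x d p → x P.:* d P.:* (P.con 1 P.:+ x P.:* d P.:* p) P.:=
             x P.:* (d P.:+ x P.:* (d P.:* (d P.:* p)))) ≋-refl X D (a⁺∘h) ⟩
    X · (D +ˢ (X · (D · (D · a⁺∘h))))
      E.≈⟨ ·-cong {f = X} {g = D +ˢ (X · (D · (D · a⁺∘h)))} ≋-refl (λ n → +-congʳ (D-unfold n)) ⟩
    X · ((one +ˢ (X · (D · (D · (after 0 ∘ˢ h))))) +ˢ (X · (D · (D · a⁺∘h))))
      E.≈⟨ P.solve 4 (λ x d p q → x P.:* (P.con 1 P.:+ x P.:* (d P.:* (d P.:* q)) P.:+ x P.:* (d P.:* (d P.:* p))) P.:=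
             x P.:+ x P.:* (x P.:* (d P.:* (d P.:* (q P.:+ p))))) ≋-refl X D a⁺∘h (after 0 ∘ˢ h) ⟩
    X +ˢ (X · (X · (D · (D · ((after 0 ∘ˢ h) +ˢ a⁺∘h)))))
      E.≈⟨ (λ n → +-congˡ (·-cong {f = X} ≋-refl (·-cong {f = X} ≋-refl (·-cong {f = D} ≋-refl
             (·-cong {f = D} {g = (after 0 ∘ˢ h) +ˢ a⁺∘h} ≋-refl cancel))) n)) ⟩
    X +ˢ (X · (X · (D · (D · 0ˢ))))
      E.≈⟨ P.solve 2 (λ x d → x P.:+ x P.:* (x P.:* (d P.:* (d P.:* P.con 0))) P.:= x) ≋-refl X D ⟩
    X E.∎
    where
    module E = ≋-Reasoning
    open TransferSeries R (λ s → - a s)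
    h = X · D
    h0 = XD0
    a⁺∘h = (λ r → a (suc r)) ∘ˢ h
    a⁺ : tail (tail (shiftSer a)) ≋ (λ r → a (suc r))
    a⁺ r = refl
    cancel : ((after 0 ∘ˢ h) +ˢ a⁺∘h) ≋ 0ˢ
    cancel = ≋-trans (≋-sym (∘-+ (after 0) (λ r → a (suc r)) h)) (≋-trans (∘-cong {h = h}
      (λ r → trans (+-congʳ (reflexive (≡.cong (λ m → - a (suc m)) (ℕ.+-identityʳ r)))) (-‿inverseˡ _)) ≋-refl) (0∘ h))

  left-inverse-unique : ∀ {f g h} → f 0 ≈ 0# → g 0 ≈ 0# → h 0 ≈ 0# →
                        (f ∘ˢ g) ≋ X → (g ∘ˢ h) ≋ X → f ≋ h
  left-inverse-unique {f} {g} {h} f0 g0 h0 fg gh = E.begin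
    f              E.≈⟨ ∘X f ⟨
    f ∘ˢ X         E.≈⟨ ∘-cong {f = f} ≋-refl gh ⟨
    f ∘ˢ (g ∘ˢ h)  E.≈⟨ ∘-assoc f g0 h0 ⟨
    (f ∘ˢ g) ∘ˢ h  E.≈⟨ ∘-cong {h = h} fg ≋-refl ⟩
    X ∘ˢ h         E.≈⟨ X∘ h0 ⟩
    h              E.∎
    where module E = ≋-Reasoning

  isCompInverse⇔ : ∀ a b → IsCompInverse (shiftSer a) (shiftSer b) ⇔
                   (∀ n → b (suc n) ≈ TransferSeries.D R (λ s → - a s) (suc n))
  isCompInverse⇔ a b = mk⇔ to from
    where
    D = TransferSeries.D R (λ s → - a s)
    to : IsCompInverse (shiftSer a) (shiftSer b) → ∀ n → b (suc n) ≈ D (suc n)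
    to (_ , ba) n = trans (left-inverse-unique refl refl (inverse-zero a) ba (shiftSer∘inverse a) (suc (suc n)))
                          (X·-suc D (suc n))
    from : (∀ n → b (suc n) ≈ D (suc n)) → IsCompInverse (shiftSer a) (shiftSer b)
    from e = ab , ba
      where
      b≋ : shiftSer b ≋ inverse a
      b≋ zero          = sym (inverse-zero a)
      b≋ (suc zero)    = sym (trans (X·-suc D 0) (trans (TransferSeries.D-unfold R (λ s → - a s) 0)
        (trans (+-congˡ (zeroˡ _)) (+-identityʳ _))))
      b≋ (suc (suc n)) = trans (e n) (sym (X·-suc D (suc n)))
      ab : (shiftSer a ∘ˢ shiftSer b) ≋ X
      ab = ≋-trans (∘-cong {f = shiftSer a} ≋-refl b≋) (shiftSer∘inverse a)
      -- The construction gives inverses on the right only. Applied to `b` as well, it gives a right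
      -- inverse of `shiftSer b`, which must coincide with the left inverse `shiftSer a`.
      a≋ : shiftSer a ≋ inverse b
      a≋ = left-inverse-unique refl refl (inverse-zero b) ab (shiftSer∘inverse b)
      ba : (shiftSer b ∘ˢ shiftSer a) ≋ X
      ba = ≋-trans (∘-cong {f = shiftSer b} ≋-refl a≋) (shiftSer∘inverse b)

-- Chains of adjacent groups and the outcome of the closure procedure.

module AdjacentClosure where
  open import Relation.Binary.PropositionalEquality
    using (_≢_; refl; sym; trans; cong; cong₂; subst)

  foldr-⊓-≤ : ∀ e xs {y} → y ∈ e ∷ xs → foldr _⊓_ e xs ≤ y
  foldr-⊓-≤ e []       (here refl)         = ℕ.≤-refl
  foldr-⊓-≤ e (x ∷ xs) (here refl)         = ℕ.≤-trans (ℕ.m⊓n≤n x _) (foldr-⊓-≤ e xs (here refl))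
  foldr-⊓-≤ e (x ∷ xs) (there (here refl)) = ℕ.m⊓n≤m x _
  foldr-⊓-≤ e (x ∷ xs) (there (there y∈))  = ℕ.≤-trans (ℕ.m⊓n≤n x _) (foldr-⊓-≤ e xs (there y∈))

  foldr-⊓-glb : ∀ {l} e xs → l ≤ e → All (l ≤_) xs → l ≤ foldr _⊓_ e xs
  foldr-⊓-glb e []       l≤e []           = l≤e
  foldr-⊓-glb e (x ∷ xs) l≤e (l≤x ∷ l≤xs) = ℕ.⊓-glb l≤x (foldr-⊓-glb e xs l≤e l≤xs)

  maxL-≤ : ∀ {m} xs → All (_≤ m) xs → maxL xs ≤ m
  maxL-≤ []       []           = z≤n
  maxL-≤ (x ∷ xs) (x≤m ∷ xs≤m) = ℕ.⊔-lub x≤m (maxL-≤ xs xs≤m)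

  ∈⇒≤maxL : ∀ {x xs} → x ∈ xs → x ≤ maxL xs
  ∈⇒≤maxL {xs = y ∷ xs} (here refl)  = ℕ.m≤m⊔n y _
  ∈⇒≤maxL {xs = y ∷ xs} (there x∈xs) = ℕ.≤-trans (∈⇒≤maxL x∈xs) (ℕ.m≤n⊔m y _)

  -- Requiring both ends to be elements excludes the empty list, on which `minL` and `maxL` take the
  -- default value 0.
  Span : ℕ → ℕ → List ℕ → Set
  Span l m xs = l ∈ xs × m ∈ xs × All (λ x → l ≤ x × x ≤ m) xs

  Span-minL : ∀ {l m xs} → Span l m xs → minL xs ≡ l
  Span-minL {xs = []}     (() , _)
  Span-minL {xs = x ∷ xs} (l∈ , _ , l≤x ∷ l≤xs) =
    ℕ.≤-antisym (foldr-⊓-≤ x xs l∈) (foldr-⊓-glb x xs (proj₁ l≤x) (All.map proj₁ l≤xs))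

  Span-maxL : ∀ {l m xs} → Span l m xs → maxL xs ≡ m
  Span-maxL {xs = xs} (_ , m∈ , b) = ℕ.≤-antisym (maxL-≤ xs (All.map proj₂ b)) (∈⇒≤maxL m∈)

  Span-≤ : ∀ {l m xs} → Span l m xs → l ≤ m
  Span-≤ (l∈ , _ , b) = proj₂ (All.lookup b l∈)

  Span-++ : ∀ {l m m′ xs ys} → Span l m xs → Span (suc m) m′ ys → Span l m′ (xs ++ ys)
  Span-++ {xs = xs} s@(l∈ , _ , b) s′@(_ , m′∈ , b′) =
    ∈-++⁺ˡ l∈ , ∈-++⁺ʳ xs m′∈ ,
    All.++⁺ (All.map (λ (l≤x , x≤m) → l≤x , ℕ.≤-trans x≤m (ℕ.<⇒≤ (Span-≤ s′))) b)
            (All.map (λ (m<x , x≤m′) → ℕ.≤-trans (ℕ.m≤n⇒m≤1+n (Span-≤ s)) m<x , x≤m′) b′)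

  Adj : Group → Group → Set
  Adj G H = suc (maxL (concat G)) ≡ minL (concat H)

  Apart : Group → Group → Set
  Apart G H = ¬ Adj G H × ¬ Adj H G

  Spanned : Group → Set
  Spanned G = ∃₂ λ l m → Span l m (concat G)

  Adj⇒Span : ∀ {G H} → Spanned G → Spanned H → Adj G H →
             ∃ λ l → ∃₂ λ m m′ → Span l m (concat G) × Span (suc m) m′ (concat H)
  Adj⇒Span {G} {H} (l , m , s) (l′ , m′ , s′) adj = l , m , m′ , s ,
    subst (λ k → Span k m′ (concat H)) (trans (sym (Span-minL s′)) (trans (sym adj) (cong suc (Span-maxL s)))) s′

  Span-merge : ∀ {l m m′} G {H} → Span l m (concat G) → Span (suc m) m′ (concat H) → Span l m′ (concat (G ++ H))
  Span-merge G {H} s s′ = subst (Span _ _) (List.concat-++ G H) (Span-++ s s′)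

  -- The union keeps the minimum of `G` and the maximum of `G′`, so it can be adjacent to `H` only
  -- where `G` (from the left) or `G′` (to the right) already was.
  Apart-merge : ∀ G G′ H → Spanned G → Spanned G′ → Adj G G′ → Apart G H → Apart G′ H → Apart (G ++ G′) H
  Apart-merge G G′ H σ σ′ adj (_ , ¬HG) (¬G′H , _) with Adj⇒Span {G} {G′} σ σ′ adj
  ... | l , m , m′ , s , s′ =
    (λ e → ¬G′H (trans (cong suc (trans (Span-maxL s′) (sym (Span-maxL s″)))) e)) ,
    (λ e → ¬HG (trans e (trans (Span-minL s″) (sym (Span-minL s)))))
    where s″ = Span-merge G s s′

  Apart-sym : ∀ {G H} → Apart G H → Apart H G
  Apart-sym (p , q) = q , p

  data Path : ℕ → List Group → ℕ → Set where
    []  : ∀ {l} → Path l [] l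
    _∷_ : ∀ {l m r G c} → Span l m (concat G) → Path (suc m) c r → Path l (G ∷ c) r

  Path-≤ : ∀ {l c r} → Path l c r → l ≤ r
  Path-≤ []      = ℕ.≤-refl
  Path-≤ (s ∷ π) = ℕ.≤-trans (ℕ.m≤n⇒m≤1+n (Span-≤ s)) (Path-≤ π)

  Path-∈ : ∀ {l c r H} → Path l c r → H ∈ c → ∃₂ λ l′ m′ → Span l′ m′ (concat H) × l ≤ l′ × m′ < r
  Path-∈ (s ∷ π) (here refl) = _ , _ , s , ℕ.≤-refl , Path-≤ π
  Path-∈ (s ∷ π) (there H∈) with Path-∈ π H∈
  ... | l′ , m′ , s′ , m<l′ , m′<r = l′ , m′ , s′ , ℕ.≤-trans (ℕ.m≤n⇒m≤1+n (Span-≤ s)) m<l′ , m′<r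

  Path-spanned : ∀ {l c r} → Path l c r → All Spanned c
  Path-spanned []      = []
  Path-spanned (s ∷ π) = (_ , _ , s) ∷ Path-spanned π

  Path-¬Adj-before : ∀ {l r} c {G G′ d} → Path l (c ++ G ∷ d) r → G′ ∈ c → ¬ Adj G G′
  Path-¬Adj-before {l} {r} (H ∷ c) {G} (s ∷ π) (here refl) adj
    with l′ , m′ , s′ , m<l′ , _ ← Path-∈ π (∈-++⁺ʳ c {ys = G ∷ _} (here refl)) =
    ℕ.<⇒≱ (ℕ.<-≤-trans (s≤s (Span-≤ s)) (ℕ.≤-trans m<l′ (ℕ.≤-trans (Span-≤ s′) (ℕ.n≤1+n m′))))
      (ℕ.≤-reflexive (trans (cong suc (sym (Span-maxL s′))) (trans adj (Span-minL s))))
  Path-¬Adj-before (H ∷ c) (s ∷ π) (there G′∈) = Path-¬Adj-before c π G′∈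

  Path-Adj-after : ∀ {l r} c {G G′ d} → Path l (c ++ G ∷ d) r → G′ ∈ d → Adj G G′ → ∃ λ e → d ≡ G′ ∷ e
  Path-Adj-after []      (s ∷ π)      (here refl) adj = _ , refl
  Path-Adj-after []      (s ∷ s₁ ∷ π) (there G′∈) adj
    with l′ , m′ , s′ , m₁<l′ , _ ← Path-∈ π G′∈ =
    ⊥-elim (ℕ.<⇒≢ (ℕ.<-≤-trans (s≤s (Span-≤ s₁)) m₁<l′)
      (trans (cong suc (sym (Span-maxL s))) (trans adj (Span-minL s′))))
  Path-Adj-after (H ∷ c) (s ∷ π)      G′∈         adj = Path-Adj-after c π G′∈ adj

  Path-Adj : ∀ {l r G G′ d} → Path l (G ∷ G′ ∷ d) r → Adj G G′
  Path-Adj (s ∷ s′ ∷ _) = trans (cong suc (Span-maxL s)) (sym (Span-minL s′))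

  Path-merge : ∀ {l r} c {G G′ d} → Path l (c ++ G ∷ G′ ∷ d) r → Path l (c ++ (G ++ G′) ∷ d) r
  Path-merge []      {G} (s ∷ s′ ∷ π) = Span-merge G s s′ ∷ π
  Path-merge (H ∷ c)     (s ∷ π)      = s ∷ Path-merge c π

  size-merge : ∀ c {G G′ : Group} {d} →
               sum (map length (c ++ (G ++ G′) ∷ d)) ≡ sum (map length (c ++ G ∷ G′ ∷ d))
  size-merge []      {G} {G′} {d} = trans (cong (ℕ._+ sum (map length d)) (List.length-++ G))
                                          (ℕ.+-assoc (length G) (length G′) _)
  size-merge (H ∷ c)              = cong (length H ℕ.+_) (size-merge c)

  NonAdjacent : List Group → List Group → Set
  NonAdjacent c gs = All (λ G → All (Apart G) gs) c

  -- gs splits into chains without adjacencies between them, and p is the product of the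
  -- Catalan numbers of the chain sizes.
  data Chains : List Group → ℕ → Set where
    []    : Chains [] 1
    chain : ∀ {l c r gs gs′ p} → Path l c r → NonAdjacent c gs → Chains gs p → gs′ ↭ c ++ gs →
            Chains gs′ (catalan (sum (map length c)) ℕ.* p)

  Chains-spanned : ∀ {gs p} → Chains gs p → All Spanned gs
  Chains-spanned []                   = []
  Chains-spanned (chain path _ ch τ) =
    All-resp-↭ (↭-sym τ) (All.++⁺ (Path-spanned path) (Chains-spanned ch))

  NonAdjacent-merge : ∀ c {G G′ d gs} → Spanned G → Spanned G′ → Adj G G′ →
                      NonAdjacent (c ++ G ∷ G′ ∷ d) gs → NonAdjacent (c ++ (G ++ G′) ∷ d) gs
  NonAdjacent-merge []      {G} {G′} σ σ′ adj (a ∷ a′ ∷ as) =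
    All.zipWith (λ {H} (p , p′) → Apart-merge G G′ H σ σ′ adj p p′) (a , a′) ∷ as
  NonAdjacent-merge (H ∷ c)          σ σ′ adj (a ∷ as)      = a ∷ NonAdjacent-merge c σ σ′ adj as

  ∈-↭ : ∀ {A : Set} {x : A} {xs} → x ∈ xs → ∃ λ ys → xs ↭ x ∷ ys
  ∈-↭ {x = x} x∈ with ys , zs , refl ← ∈-∃++ x∈ = ys ++ zs , shift x ys zs

  -- The invariant must survive the merge of an arbitrary adjacent pair. No adjacency links
  -- different chains, so both groups lie in one chain, where `G′` must directly follow `G`. Merging
  -- them preserves the number of blocks in the chain, hence `p`.
  Chains-merge : ∀ {gs p G G′ rest} → Chains gs p → gs ↭ G ∷ G′ ∷ rest → Adj G G′ → Chains ((G ++ G′) ∷ rest) p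
  Chains-merge [] τ adj = ⊥-elim (¬x∷xs↭[] (↭-sym τ))
  Chains-merge {G = G} {G′} {rest} ch₀@(chain {l} {c} {r} {gs} {gs′} {p} path apart ch τ₀) τ adj =
    go (∈-++⁻ c (∈-resp-↭ σ (here refl)))
    where
    σ : G ∷ G′ ∷ rest ↭ c ++ gs
    σ = ↭-trans (↭-sym τ) τ₀
    spanned : All Spanned (G ∷ G′ ∷ rest)
    spanned = All-resp-↭ τ (Chains-spanned ch₀)
    σG  = All.head spanned
    σG′ = All.head (All.tail spanned)

    inChain : ∀ c₁ c₂ → c ≡ c₁ ++ G ∷ c₂ → Chains ((G ++ G′) ∷ rest) (catalan (sum (map length c)) ℕ.* p)
    inChain c₁ c₂ refl with ∈-++⁻ c₁ (∈-resp-↭ σ₁ (here refl))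
      where
      σ₁ : G′ ∷ rest ↭ c₁ ++ (c₂ ++ gs)
      σ₁ = drop-mid [] c₁ (subst (_ ↭_) (List.++-assoc c₁ (G ∷ c₂) gs) σ)
    ... | inj₁ G′∈c₁ = ⊥-elim (Path-¬Adj-before c₁ path G′∈c₁ adj)
    ... | inj₂ G′∈ with ∈-++⁻ c₂ G′∈
    ...   | inj₂ G′∈gs = ⊥-elim (proj₁ (All.lookup (All.lookup apart (∈-++⁺ʳ c₁ (here refl))) G′∈gs) adj)
    ...   | inj₁ G′∈c₂ with c₃ , refl ← Path-Adj-after c₁ path G′∈c₂ adj =
      subst (λ k → Chains _ (catalan k ℕ.* p)) (size-merge c₁)
        (chain (Path-merge c₁ path) (NonAdjacent-merge c₁ σG σG′ adj apart) ch merged)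
      where
      σ₂ : rest ↭ c₁ ++ (c₃ ++ gs)
      σ₂ = drop-mid [] c₁ (drop-mid [] c₁ (subst (_ ↭_) (List.++-assoc c₁ (G ∷ G′ ∷ c₃) gs) σ))
      merged : (G ++ G′) ∷ rest ↭ (c₁ ++ (G ++ G′) ∷ c₃) ++ gs
      merged = subst (_ ↭_) (sym (List.++-assoc c₁ ((G ++ G′) ∷ c₃) gs))
        (↭-trans (prep _ σ₂) (↭-sym (shift (G ++ G′) c₁ (c₃ ++ gs))))

    outsideChain : ∀ gs₁ → gs ↭ G ∷ gs₁ → Chains ((G ++ G′) ∷ rest) (catalan (sum (map length c)) ℕ.* p)
    outsideChain gs₁ τ₁ with ∈-++⁻ c (∈-resp-↭ σ₁ (here refl))
      where
      σ₁ : G′ ∷ rest ↭ c ++ gs₁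
      σ₁ = drop-mid [] c (↭-trans σ (++⁺ˡ c τ₁))
    ... | inj₁ G′∈c = ⊥-elim (proj₂ (All.lookup (All.lookup apart G′∈c) (∈-resp-↭ (↭-sym τ₁) (here refl))) adj)
    ... | inj₂ G′∈gs₁ with gs₂ , τ₂ ← ∈-↭ G′∈gs₁ =
      chain path (All.map (λ {H} → apart′ {H}) apart) (Chains-merge ch τ₃ adj)
        (↭-trans (prep _ σ₂) (↭-sym (shift (G ++ G′) c gs₂)))
      where
      τ₃ : gs ↭ G ∷ G′ ∷ gs₂
      τ₃ = ↭-trans τ₁ (prep G τ₂)
      σ₂ : rest ↭ c ++ gs₂
      σ₂ = drop-mid [] c (drop-mid [] c (↭-trans σ (++⁺ˡ c τ₃)))
      apart′ : ∀ {H} → All (Apart H) gs → All (Apart H) ((G ++ G′) ∷ gs₂)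
      apart′ {H} as with All-resp-↭ τ₃ as
      ... | a ∷ a′ ∷ as′ = Apart-sym {G ++ G′} {H}
        (Apart-merge G G′ H σG σG′ adj (Apart-sym {H} {G} a) (Apart-sym {H} {G′} a′)) ∷ as′

    go : G ∈ c ⊎ G ∈ gs → Chains ((G ++ G′) ∷ rest) (catalan (sum (map length c)) ℕ.* p)
    go (inj₁ G∈c)  with c₁ , c₂ , e ← ∈-∃++ G∈c = inChain c₁ c₂ e
    go (inj₂ G∈gs) with gs₁ , τ₁ ← ∈-↭ G∈gs = outsideChain gs₁ τ₁

  Closed : List Group → Set
  Closed gs = ∀ {G G′ rest} → gs ↭ G ∷ G′ ∷ rest → ¬ Adj G G′

  catalanProduct : List Group → ℕ
  catalanProduct = product ∘ map (catalan ∘ length)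

  -- Successive groups of a path are adjacent, so in a closed list each chain has at most one group;
  -- the empty chain is harmless because `catalan 0` is 1.
  Chains-closed : ∀ {gs p} → Chains gs p → Closed gs → catalanProduct gs ≡ p
  Chains-closed [] _ = refl
  Chains-closed (chain {c = c} {gs = gs} {gs′} path _ ch τ) closed = trans
    (product-↭ (map⁺ (catalan ∘ length) τ))
    (trans (cong product (List.map-++ (catalan ∘ length) c gs))
    (trans (product-++ (map (catalan ∘ length) c) _)
    (cong₂ ℕ._*_ (single c path closed-c)
      (Chains-closed ch (λ τ′ → closed (↭-trans τ (↭-trans (++-comm c gs) (++⁺ʳ c τ′))))))))
    where
    closed-c : ∀ {G G′ d} → c ≡ G ∷ G′ ∷ d → ¬ Adj G G′
    closed-c refl = closed τ
    single : ∀ {l r} c → Path l c r → (∀ {G G′ d} → c ≡ G ∷ G′ ∷ d → ¬ Adj G G′) →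
             catalanProduct c ≡ catalan (sum (map length c))
    single []           _    _ = refl
    single (G ∷ [])     _    _ = trans (ℕ.*-identityʳ _) (cong catalan (sym (ℕ.+-identityʳ (length G))))
    single (G ∷ G′ ∷ d) path ¬adj = ⊥-elim (¬adj refl (Path-Adj {G = G} {G′} path))

  -- The closure procedure

  ∈-picks⁻ : ∀ {A : Set} (xs : List A) {y ys} → (y , ys) ∈ picks xs → xs ↭ y ∷ ys
  ∈-picks⁻ (x ∷ xs) (here refl) = ↭-refl
  ∈-picks⁻ (x ∷ xs) (there p∈) with ∈-map⁻ _ p∈
  ... | (y , ys) , q∈ , refl = ↭-trans (prep x (∈-picks⁻ xs q∈)) (swap x y ↭-refl)

  ∈-picks⁺ : ∀ {A : Set} {xs : List A} {y} → y ∈ xs → ∃ λ ys → (y , ys) ∈ picks xs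
  ∈-picks⁺ (here refl) = _ , here refl
  ∈-picks⁺ (there y∈) with ys , p∈ ← ∈-picks⁺ y∈ = _ , there (∈-map⁺ _ p∈)

  -- `mergeSteps` concatenates by a local function that cannot be named outside. Its two defining
  -- equations identify it with `_++_`.
  ≡-++ : ∀ {A : Set} (_⊕_ : List A → List A → List A) →
         (∀ ys → [] ⊕ ys ≡ ys) → (∀ x xs ys → (x ∷ xs) ⊕ ys ≡ x ∷ (xs ⊕ ys)) → ∀ xs ys → xs ⊕ ys ≡ xs ++ ys
  ≡-++ _⊕_ []⊕ ∷⊕ []       ys = []⊕ ys
  ≡-++ _⊕_ []⊕ ∷⊕ (x ∷ xs) ys = trans (∷⊕ x xs ys) (cong (x ∷_) (≡-++ _⊕_ []⊕ ∷⊕ xs ys))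

  adjacent⇒Adj : ∀ G H → adjacent G H ≡ true → Adj G H
  adjacent⇒Adj G H e = ℕ.≡ᵇ⇒≡ _ _ (Equivalence.from T-≡ e)

  Adj⇒adjacent : ∀ G H → Adj G H → adjacent G H ≡ true
  Adj⇒adjacent G H e = Equivalence.to T-≡ (ℕ.≡⇒≡ᵇ (suc (maxL (concat G))) (minL (concat H)) e)

  mergeSteps-unfold : ∀ gs → mergeSteps gs ≡
    concatMap (λ (G , r) → concatMap (λ (G′ , r′) → if adjacent G G′ then [ (G ++ G′) ∷ r′ ] else []) (picks r)) (picks gs)
  mergeSteps-unfold gs = List.concatMap-cong (λ (G , r) → List.concatMap-cong (λ (G′ , r′) →
    cong (λ H → if adjacent G G′ then [ H ∷ r′ ] else []) (append G G′)) (picks r)) (picks gs)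
    where
    append : ∀ G H → _ ≡ G ++ H
    append = ≡-++ _ (λ _ → refl) (λ _ _ _ → refl)

  ∈-mergeSteps⁻ : ∀ gs {gs′} → gs′ ∈ mergeSteps gs →
    ∃ λ G → ∃₂ λ G′ rest → gs ↭ G ∷ G′ ∷ rest × Adj G G′ × gs′ ≡ (G ++ G′) ∷ rest
  ∈-mergeSteps⁻ gs gs′∈
    with (G , r) , p∈ , gs′∈₁ ← find (∈-concatMap⁻ _ {xs = picks gs} (subst (_ ∈_) (mergeSteps-unfold gs) gs′∈))
    with (G′ , r′) , q∈ , gs′∈₂ ← find (∈-concatMap⁻ _ {xs = picks r} gs′∈₁)
    with adjacent G G′ in e | gs′∈₂
  ... | true | here refl = G , G′ , r′ , ↭-trans (∈-picks⁻ gs p∈) (prep G (∈-picks⁻ r q∈)) ,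
    adjacent⇒Adj G G′ e , refl

  mergeSteps≡[]⇒Closed : ∀ gs → mergeSteps gs ≡ [] → Closed gs
  mergeSteps≡[]⇒Closed gs e {G} {G′} τ adj
    with r , p∈ ← ∈-picks⁺ (∈-resp-↭ (↭-sym τ) (here refl))
    with r′ , q∈ ← ∈-picks⁺ {y = G′} (∈-resp-↭ (↭-sym (drop-∷ (↭-trans (↭-sym (∈-picks⁻ gs p∈)) τ))) (here refl))
    = nonempty (∈-concatMap⁺ _ (lose p∈ (∈-concatMap⁺ _ (lose q∈ merged)))) (trans (sym (mergeSteps-unfold gs)) e)
    where
    nonempty : ∀ {A : Set} {x : A} {xs} → x ∈ xs → xs ≢ []
    nonempty (here _) ()
    merged : ∀ {A : Set} {x : A} → x ∈ (if adjacent G G′ then [ x ] else [])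
    merged rewrite Adj⇒adjacent G G′ adj = here refl

  -- Each merge removes one group, so with fuel at least `length gs` the procedure stops only at a
  -- closed list; fuel zero leaves the empty one.
  closeGroups-Chains : ∀ k gs {p} → length gs ≤ k → Chains gs p → catalanProduct (closeGroups k gs) ≡ p
  closeGroups-Chains zero    []       _  ch = Chains-closed ch (λ τ → ⊥-elim (¬x∷xs↭[] (↭-sym τ)))
  closeGroups-Chains (suc k) gs       le ch with mergeSteps gs in e
  ... | []      = Chains-closed ch (mergeSteps≡[]⇒Closed gs e)
  ... | gs′ ∷ _ with G , G′ , rest , τ , adj , refl ← ∈-mergeSteps⁻ gs (subst (gs′ ∈_) (sym e) (here refl)) =
    closeGroups-Chains k gs′ (ℕ.≤-pred (ℕ.≤-trans (ℕ.≤-reflexive (sym (↭-length τ))) le)) (Chains-merge ch τ adj)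

  catalanCoeff-Chains : ∀ π {p} → Chains (map [_] π) p → catalanCoeff π ≡ p
  catalanCoeff-Chains π ch = trans (foldr-product (adjacentClosure π))
    (closeGroups-Chains (length π) (map [_] π) (ℕ.≤-reflexive (List.length-map [_] π)) ch)
    where
    foldr-product : ∀ gs → foldr (λ G r → catalan (length G) ℕ.* r) 1 gs ≡ catalanProduct gs
    foldr-product []       = refl
    foldr-product (G ∷ gs) = cong (catalan (length G) ℕ.*_) (foldr-product gs)

-- Noncrossing partitions built element by element.

module NoncrossingPartitions where
  open AdjacentClosure
  open import Relation.Binary.PropositionalEquality
    using (_≢_; refl; sym; trans; cong; cong₂; subst; module ≡-Reasoning)

  -- Crossings

  Same : Partition → ℕ → ℕ → Set
  Same π y z = Any (λ B → y ∈ B × z ∈ B) π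

  record Crossing (n : ℕ) (π : Partition) : Set where
    constructor crosses
    field
      {a b c d} : ℕ
      1≤a       : 1 ≤ a
      a<b       : a < b
      b<c       : b < c
      c<d       : c < d
      d≤n       : d ≤ n
      a~c       : Same π a c
      b~d       : Same π b d
      a≁b       : ¬ Same π a b

  module _ where
    open Equivalence

    ∈ᵇ⇒∈ : ∀ {x} B → T (x ∈ᵇ B) → x ∈ B
    ∈ᵇ⇒∈ {x} B = Any.map (λ {y} → ℕ.≡ᵇ⇒≡ x y) ∘ Any.any⁻ (x ≡ᵇ_) B

    ∈⇒∈ᵇ : ∀ {x B} → x ∈ B → T (x ∈ᵇ B)
    ∈⇒∈ᵇ {x} = Any.any⁺ (x ≡ᵇ_) ∘ Any.map (λ {y} → ℕ.≡⇒≡ᵇ x y)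

    sameBlock⇒Same : ∀ π {y z} → T (sameBlock π y z) → Same π y z
    sameBlock⇒Same π = Any.map (λ {B} t → ∈ᵇ⇒∈ B (proj₁ (to T-∧ t)) , ∈ᵇ⇒∈ B (proj₂ (to T-∧ t))) ∘ Any.any⁻ _ π

    Same⇒sameBlock : ∀ {π y z} → Same π y z → T (sameBlock π y z)
    Same⇒sameBlock = Any.any⁺ _ ∘ Any.map (λ (y∈ , z∈) → from T-∧ (∈⇒∈ᵇ y∈ , ∈⇒∈ᵇ z∈))

    T-not⁺ : ∀ {b} → ¬ T b → T (not b)
    T-not⁺ {true}  f = f _
    T-not⁺ {false} f = _

    T-not⁻ : ∀ {b} → T (not b) → ¬ T b
    T-not⁻ {false} _ ()

    ∈-range⁺ : ∀ {n x} → 1 ≤ x → x ≤ n → x ∈ range n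
    ∈-range⁺ {x = suc x} _ x<n = ∈-map⁺ suc (∈-upTo⁺ x<n)

    ∈-range⁻ : ∀ {n x} → x ∈ range n → 1 ≤ x × x ≤ n
    ∈-range⁻ x∈ with _ , y∈ , refl ← ∈-map⁻ suc x∈ = s≤s z≤n , ∈-upTo⁻ y∈

    any-range⁻ : ∀ n (p : ℕ → Bool) → T (any p (range n)) → ∃ λ x → x ∈ range n × T (p x)
    any-range⁻ n p t = find (Any.any⁻ p (range n) t)

    any-range⁺ : ∀ {n x} (p : ℕ → Bool) → 1 ≤ x → x ≤ n → T (p x) → T (any p (range n))
    any-range⁺ p 1≤x x≤n t = Any.any⁺ p (lose (∈-range⁺ 1≤x x≤n) t)

    crossing⇒Crossing : ∀ n π → T (crossing n π) → Crossing n π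
    crossing⇒Crossing n π t =
      let a , a∈ , t₁ = any-range⁻ n _ t
          b , _  , t₂ = any-range⁻ n _ t₁
          c , _  , t₃ = any-range⁻ n _ t₂
          d , d∈ , t₄ = any-range⁻ n _ t₃
          a<b , t₅ = to (T-∧ {a <ᵇ b}) t₄
          b<c , t₆ = to (T-∧ {b <ᵇ c}) t₅
          c<d , t₇ = to (T-∧ {c <ᵇ d}) t₆
          a~c , t₈ = to (T-∧ {sameBlock π a c}) t₇
          b~d , t₉ = to (T-∧ {sameBlock π b d}) t₈
      in crosses (proj₁ (∈-range⁻ a∈)) (ℕ.<ᵇ⇒< a b a<b) (ℕ.<ᵇ⇒< b c b<c) (ℕ.<ᵇ⇒< c d c<d) (proj₂ (∈-range⁻ {n} d∈))
           (sameBlock⇒Same π a~c) (sameBlock⇒Same π b~d) (T-not⁻ t₉ ∘ Same⇒sameBlock)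

    Crossing⇒crossing : ∀ {n π} → Crossing n π → T (crossing n π)
    Crossing⇒crossing {n} {π} (crosses {a} {b} {c} {d} 1≤a a<b b<c c<d d≤n a~c b~d a≁b) =
      any-range⁺ _ 1≤a (ℕ.≤-trans a≤b (ℕ.≤-trans b≤c c≤n))
        (any-range⁺ _ (ℕ.≤-trans 1≤a a≤b) (ℕ.≤-trans b≤c c≤n)
          (any-range⁺ _ (ℕ.≤-trans 1≤a (ℕ.≤-trans a≤b b≤c)) c≤n
            (any-range⁺ _ (ℕ.≤-trans 1≤a (ℕ.≤-trans a≤b (ℕ.≤-trans b≤c (ℕ.<⇒≤ c<d)))) d≤n
              (from T-∧ (ℕ.<⇒<ᵇ a<b , from T-∧ (ℕ.<⇒<ᵇ b<c , from T-∧ (ℕ.<⇒<ᵇ c<d ,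
               from T-∧ (Same⇒sameBlock a~c , from T-∧ (Same⇒sameBlock b~d ,
               T-not⁺ (a≁b ∘ sameBlock⇒Same π))))))))))
      where
      a≤b = ℕ.<⇒≤ a<b
      b≤c = ℕ.<⇒≤ b<c
      c≤n = ℕ.≤-trans (ℕ.<⇒≤ c<d) d≤n

  -- Extending a partition of [n] by n + 1

  data _⊏[_]_ : Partition → ℕ → Partition → Set where
    new  : ∀ {π x} → π ⊏[ x ] ([ x ] ∷ π)
    join : ∀ π₁ {B π₂ x} → (π₁ ++ B ∷ π₂) ⊏[ x ] (π₁ ++ (x ∷ B) ∷ π₂)

  Same-⊏ : ∀ {π x π′ y z} → π ⊏[ x ] π′ → Same π y z → Same π′ y z
  Same-⊏ new       s = there s
  Same-⊏ (join π₁) s with Any.++⁻ π₁ s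
  ... | inj₁ s₁                = Any.++⁺ˡ s₁
  ... | inj₂ (here (y∈ , z∈)) = Any.++⁺ʳ π₁ (here (there y∈ , there z∈))
  ... | inj₂ (there s₂)        = Any.++⁺ʳ π₁ (there s₂)

  Same-⊏⁻ : ∀ {π x π′ y z} → π ⊏[ x ] π′ → y < x → z < x → Same π′ y z → Same π y z
  Same-⊏⁻ new       y<x z<x (here (here refl , _)) = ⊥-elim (ℕ.<-irrefl refl y<x)
  Same-⊏⁻ new       y<x z<x (there s) = s
  Same-⊏⁻ (join π₁) y<x z<x s with Any.++⁻ π₁ s
  ... | inj₁ s₁                            = Any.++⁺ˡ s₁
  ... | inj₂ (there s₂)                    = Any.++⁺ʳ π₁ (there s₂)
  ... | inj₂ (here (here refl , _))        = ⊥-elim (ℕ.<-irrefl refl y<x)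
  ... | inj₂ (here (there _ , here refl))  = ⊥-elim (ℕ.<-irrefl refl z<x)
  ... | inj₂ (here (there y∈ , there z∈)) = Any.++⁺ʳ π₁ (here (y∈ , z∈))

  Crossing-⊏ : ∀ {n π π′} → π ⊏[ suc n ] π′ → Crossing n π → Crossing (suc n) π′
  Crossing-⊏ e (crosses 1≤a a<b b<c c<d d≤n a~c b~d a≁b) =
    crosses 1≤a a<b b<c c<d (ℕ.m≤n⇒m≤1+n d≤n) (Same-⊏ e a~c) (Same-⊏ e b~d)
      (a≁b ∘ Same-⊏⁻ e (ℕ.<-trans a<b b<1+n) b<1+n)
    where b<1+n = ℕ.<-trans b<c (ℕ.<-≤-trans c<d (ℕ.m≤n⇒m≤1+n d≤n))

  -- A crossing created by the extension must involve `n + 1`, which as the largest number can only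
  -- be its last point `d`.
  Crossing-⊏⁻ : ∀ {n π π′} → π ⊏[ suc n ] π′ → Crossing (suc n) π′ →
    Crossing n π ⊎ ∃ λ a → ∃₂ λ b c → a < b × b < c × c ≤ n × Same π′ a c × Same π′ b (suc n) × ¬ Same π′ a b
  Crossing-⊏⁻ e (crosses 1≤a a<b b<c c<d d≤1+n a~c b~d a≁b) with ℕ.m≤n⇒m<n∨m≡n d≤1+n
  ... | inj₂ refl  = inj₂ (_ , _ , _ , a<b , b<c , ℕ.≤-pred c<d , a~c , b~d , a≁b)
  ... | inj₁ d<1+n = inj₁ (crosses 1≤a a<b b<c c<d (ℕ.≤-pred d<1+n)
    (Same-⊏⁻ e (ℕ.<-trans a<b b<x) c<x a~c) (Same-⊏⁻ e b<x d<1+n b~d) (a≁b ∘ Same-⊏ e))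
    where
    c<x = ℕ.<-trans c<d d<1+n
    b<x = ℕ.<-trans b<c c<x

  ∈-insertEverywhere : ∀ {x} π {π′} → π′ ∈ insertEverywhere x π →
    ∃ λ π₁ → ∃₂ λ B π₂ → π ≡ π₁ ++ B ∷ π₂ × π′ ≡ π₁ ++ (x ∷ B) ∷ π₂
  ∈-insertEverywhere (B ∷ π) (here refl) = [] , B , π , refl , refl
  ∈-insertEverywhere (B ∷ π) (there π′∈)
    with _ , π″∈ , refl ← ∈-map⁻ (B ∷_) π′∈
    with π₁ , B′ , π₂ , refl , refl ← ∈-insertEverywhere π π″∈ = B ∷ π₁ , B′ , π₂ , refl , refl

  -- With `N` the blocks nested in the outer block `B`, this separates the three fates of `x`: into
  -- `N`, where it creates a crossing; into `B`; or into a later block of the list.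
  insertEverywhere-++ : ∀ x N B π → insertEverywhere x (N ++ B ∷ π) ≡
    map (_++ B ∷ π) (insertEverywhere x N) ++
    (N ++ (x ∷ B) ∷ π) ∷ map ((N ++ [ B ]) ++_) (insertEverywhere x π)
  insertEverywhere-++ x []      B π = refl
  insertEverywhere-++ x (M ∷ N) B π = cong (((x ∷ M) ∷ N ++ B ∷ π) ∷_) (begin
    map (M ∷_) (insertEverywhere x (N ++ B ∷ π))
      ≡⟨ cong (map (M ∷_)) (insertEverywhere-++ x N B π) ⟩
    map (M ∷_) (map (_++ B ∷ π) (insertEverywhere x N) ++ _)
      ≡⟨ List.map-++ (M ∷_) (map (_++ B ∷ π) (insertEverywhere x N)) _ ⟩
    map (M ∷_) (map (_++ B ∷ π) (insertEverywhere x N)) ++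
      (M ∷ N ++ (x ∷ B) ∷ π) ∷ map (M ∷_) (map ((N ++ [ B ]) ++_) (insertEverywhere x π))
      ≡⟨ cong₂ (λ k l → k ++ (M ∷ N ++ (x ∷ B) ∷ π) ∷ l)
           (trans (sym (List.map-∘ (insertEverywhere x N))) (List.map-∘ (insertEverywhere x N)))
           (sym (List.map-∘ (insertEverywhere x π))) ⟩
    _ ∎)
    where open ≡-Reasoning

  module _ {A : Set} (p : A → Bool) where

    filterᵇ-++ : ∀ xs ys → filterᵇ p (xs ++ ys) ≡ filterᵇ p xs ++ filterᵇ p ys
    filterᵇ-++ []       ys = refl
    filterᵇ-++ (x ∷ xs) ys with p x
    ... | true  = cong (x ∷_) (filterᵇ-++ xs ys)
    ... | false = filterᵇ-++ xs ys

    filterᵇ-none : ∀ {xs} → All (λ x → p x ≡ false) xs → filterᵇ p xs ≡ []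
    filterᵇ-none []                     = refl
    filterᵇ-none (px ∷ pxs) rewrite px = filterᵇ-none pxs

    filterᵇ-accept : ∀ {x} xs → p x ≡ true → filterᵇ p (x ∷ xs) ≡ x ∷ filterᵇ p xs
    filterᵇ-accept xs px rewrite px = refl

    filterᵇ-concatMap : ∀ {B : Set} (f : B → List A) xs → filterᵇ p (concatMap f xs) ≡ concatMap (filterᵇ p ∘ f) xs
    filterᵇ-concatMap f []       = refl
    filterᵇ-concatMap f (x ∷ xs) = trans (filterᵇ-++ (f x) (concatMap f xs)) (cong (filterᵇ p (f x) ++_) (filterᵇ-concatMap f xs))

    concatMap-filterᵇ : ∀ {B : Set} (f : A → List B) → (∀ x → p x ≡ false → f x ≡ []) →
                        ∀ xs → concatMap f xs ≡ concatMap f (filterᵇ p xs)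
    concatMap-filterᵇ f e []       = refl
    concatMap-filterᵇ f e (x ∷ xs) with p x in px
    ... | true  = cong (f x ++_) (concatMap-filterᵇ f e xs)
    ... | false = cong₂ _++_ (e x px) (concatMap-filterᵇ f e xs)

  concatMap-cong-All : ∀ {A B : Set} {f g : A → List B} {xs} → All (λ x → f x ≡ g x) xs → concatMap f xs ≡ concatMap g xs
  concatMap-cong-All []       = refl
  concatMap-cong-All (e ∷ es) = cong₂ _++_ e (concatMap-cong-All es)

  noncrossing : ℕ → Partition → Bool
  noncrossing n π = not (crossing n π)

  T⇒not≡false : ∀ {b} → T b → not b ≡ false
  T⇒not≡false {true} _ = refl

  ¬T⇒not≡true : ∀ {b} → ¬ T b → not b ≡ true
  ¬T⇒not≡true {true}  f = ⊥-elim (f _)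
  ¬T⇒not≡true {false} f = refl

  not≡false⇒T : ∀ b → not b ≡ false → T b
  not≡false⇒T true _ = _

  Crossing⇒noncrossing≡false : ∀ {n π} → Crossing n π → noncrossing n π ≡ false
  Crossing⇒noncrossing≡false cr = T⇒not≡false (Crossing⇒crossing cr)

  ¬Crossing⇒noncrossing≡true : ∀ {n π} → ¬ Crossing n π → noncrossing n π ≡ true
  ¬Crossing⇒noncrossing≡true ¬cr = ¬T⇒not≡true (¬cr ∘ crossing⇒Crossing _ _)

  noncrossing≡false⇒Crossing : ∀ n π → noncrossing n π ≡ false → Crossing n π
  noncrossing≡false⇒Crossing n π e = crossing⇒Crossing n π (not≡false⇒T (crossing n π) e)

  -- An outer block together with the blocks nested in it.
  Entry : Set
  Entry = List Block × Block

  -- A new block goes to the front, and an outer block that grows takes the blocks in front of it as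
  -- nested ones. Thus `flatten` reproduces the exact block order of `partitions`, and `NC≡states`
  -- can be an equality of lists.
  flatten : List Entry → Partition
  flatten []            = []
  flatten ((N , B) ∷ o) = N ++ B ∷ flatten o

  outerBlocks : List Entry → List Block
  outerBlocks = map proj₂

  -- A noncrossing partition: its outer blocks from right to left, its other blocks, and the
  -- product of the Catalan numbers of the chains formed by the latter.
  record State : Set where
    constructor state
    field
      outer  : List Entry
      nested : List Block
      coeff  : ℕ
  open State

  partition : State → Partition
  partition = flatten ∘ outer

  -- `P` holds all blocks on the right of the current entry and `A` the outer ones among them. When
  -- `x` joins `B`, the former become nested and the latter a finished chain, whence the factor
  -- `catalan (length A)`. Consing while moving left keeps `A` in increasing order.
  joinOuter : ℕ → List Block → List Block → List Entry → List Block → ℕ → List State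
  joinOuter x P A []            cl q = []
  joinOuter x P A ((N , B) ∷ o) cl q =
    state ((P ++ N , x ∷ B) ∷ o) (A ++ cl) (catalan (length A) ℕ.* q) ∷ joinOuter x (P ++ N ++ [ B ]) (B ∷ A) o cl q

  extend : ℕ → State → List State
  extend x (state o cl q) = state (([] , [ x ]) ∷ o) cl q ∷ joinOuter x [] [] o cl q

  states : ℕ → List State
  states zero    = [ state [] [] 1 ]
  states (suc n) = concatMap (extend (suc n)) (states n)

  -- The last condition puts `M` inside a single gap of `B`; its case `a = b = c` makes the two
  -- disjoint.
  Nested : Block → ℕ → ℕ → Block → Set
  Nested B l m M = ∃ (_∈ M) × All (λ y → l < y × y < m) M ×
                   (∀ {a b c} → a ∈ M → b ∈ B → c ∈ M → a ≤ b → b ≤ c → ⊥)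

  -- The spans of the outer blocks tile the numbers from 1 to `v - 1` without holes, which is why
  -- these blocks always form one chain.
  data Tower : ℕ → List Entry → Set where
    []    : Tower 1 []
    tower : ∀ {l m N B o} → Span l m B → All (Nested B l m) N → Tower l o → Tower (suc m) ((N , B) ∷ o)

  Tower-bounds : ∀ {v o} → Tower v o → 1 ≤ v × All (All (λ y → y < v)) (flatten o)
  Tower-bounds [] = s≤s z≤n , []
  Tower-bounds (tower s nest tw) with Tower-bounds tw
  ... | 1≤l , b = s≤s z≤n ,
    All.++⁺ (All.map (λ (_ , bM , _) → All.map (λ (_ , y<m) → ℕ.m≤n⇒m≤1+n y<m) bM) nest)
      (All.map (s≤s ∘ proj₂) (proj₂ (proj₂ s)) ∷
       All.map (All.map (λ y<l → ℕ.≤-trans y<l (ℕ.m≤n⇒m≤1+n (Span-≤ s)))) b)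

  -- The outer blocks of a noncrossing partition of [n] split at v: those on the right of v form
  -- the chain A and account, with the blocks nested in them, for P; those on the left of v are in o.
  record Cut (n v : ℕ) (P : List Block) (A : List Block) (o : List Entry) (cl : List Block) (q : ℕ) : Set where
    field
      left    : Tower v o
      right   : Path v (map [_] A) (suc n)
      bounds  : All (λ M → ∃ (_∈ M) × All (λ y → v ≤ y × y ≤ n) M) P
      blocks  : P ++ flatten o ↭ A ++ outerBlocks o ++ cl
      chains  : Chains (map [_] cl) q
      apart   : NonAdjacent (map [_] (A ++ outerBlocks o)) (map [_] cl)
      -- Strictly below `n`: a finished group with maximum `n` would be adjacent to the new block
      -- `[ suc n ]`.
      below   : All (λ H → maxL (concat H) < n) (map [_] cl)
      ¬crosses : ¬ Crossing n (P ++ flatten o)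
  open Cut

  Valid : ℕ → State → Set
  Valid n (state o cl q) = Cut n (suc n) [] [] o cl q

  Span-[_] : ∀ B {l m} → Span l m B → Span l m (concat [ B ])
  Span-[ B ] = subst (Span _ _) (sym (List.++-identityʳ B))

  -- Moves the cut past one outer block of the same partition. Once `o` is exhausted, `right`
  -- exhibits all outer blocks as a single path.
  Cut-advance : ∀ {n v P A N B o cl q} → Cut n v P A ((N , B) ∷ o) cl q →
                ∃ λ l → Cut n l (P ++ N ++ [ B ]) (B ∷ A) o cl q
  Cut-advance {n} {P = P} {A} {N} {B} {o} {cl} cut with left cut
  ... | tower {l} {m} s nest tw = l , record
    { left    = tw
    ; right   = Span-[ B ] s ∷ right cut
    ; bounds  = All.++⁺ (All.map (λ (y , b) → y , All.map (λ (v≤y , y≤n) → ℕ.≤-trans l≤v v≤y , y≤n) b) (bounds cut))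
               (All.++⁺ (All.map (λ (y , b , _) → y , All.map (λ (l<y , y<m) → ℕ.<⇒≤ l<y , ℕ.≤-trans (ℕ.<⇒≤ y<m) m≤n) b) nest)
                        ((( _ , proj₁ s) , All.map (λ (l≤y , y≤m) → l≤y , ℕ.≤-trans y≤m m≤n) (proj₂ (proj₂ s))) ∷ []))
    ; blocks  = ↭-trans (↭-reflexive assoc) (↭-trans (blocks cut) (shift B A _))
    ; chains  = chains cut
    ; apart   = All-resp-↭ (map⁺ [_] (shift B A _)) (apart cut)
    ; below   = below cut
    ; ¬crosses = subst (¬_ ∘ Crossing n) (sym assoc) (¬crosses cut)
    }
    where
    l≤v = ℕ.m≤n⇒m≤1+n (Span-≤ s)
    m≤n = ℕ.≤-pred (Path-≤ (right cut))
    assoc : (P ++ N ++ [ B ]) ++ flatten o ≡ P ++ N ++ B ∷ flatten o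
    assoc = trans (List.++-assoc P (N ++ [ B ]) (flatten o)) (cong (P ++_) (List.++-assoc N [ B ] (flatten o)))

  module _ {n v P A N B o cl q} (cut : Cut n v P A ((N , B) ∷ o) cl q) where
    private
      x = suc n

    -- In a new crossing `a < b < c < n + 1` the point `b` lies in `B`. A block through `a` and `c`
    -- cannot be on the right of `B` (as `a < b`), nor on its left (as `b < c`), nor in a gap of
    -- `B`, nor `B` itself.
    join-¬crosses : ¬ Crossing x ((P ++ N) ++ (x ∷ B) ∷ flatten o)
    join-¬crosses cr with left cut
    ... | tower {l} {m} s nest tw = contra (Crossing-⊏⁻ (join (P ++ N)) cr)
      where
      m≤n = ℕ.≤-pred (Path-≤ (right cut))
      bo  = proj₂ (Tower-bounds tw)
      notTop : ∀ {b} → Same ((P ++ N) ++ (x ∷ B) ∷ flatten o) b x → b ≤ n → b ∈ B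
      notTop same b≤n with Any.++⁻ (P ++ N) same
      ... | inj₂ (here (here refl , _)) = ⊥-elim (ℕ.<-irrefl refl b≤n)
      ... | inj₂ (here (there b∈ , _))  = b∈
      ... | inj₂ (there same₂) with M , M∈ , _ , x∈ ← find same₂ =
        ⊥-elim (ℕ.<⇒≱ (All.lookup (All.lookup bo M∈) x∈)
          (ℕ.≤-trans (Span-≤ s) (ℕ.≤-trans m≤n (ℕ.n≤1+n n))))
      ... | inj₁ same₁ with Any.++⁻ P same₁
      ...   | inj₁ p with M , M∈ , _ , x∈ ← find p =
        ⊥-elim (ℕ.<-irrefl refl (proj₂ (All.lookup (proj₂ (All.lookup (bounds cut) M∈)) x∈)))
      ...   | inj₂ p with M , M∈ , _ , x∈ ← find p =
        ⊥-elim (ℕ.<⇒≱ (proj₂ (All.lookup (proj₁ (proj₂ (All.lookup nest M∈))) x∈)) (ℕ.≤-trans m≤n (ℕ.n≤1+n n)))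
      contra : Crossing n ((P ++ N) ++ B ∷ flatten o) ⊎ _ → ⊥
      contra (inj₁ cr′) = ¬crosses cut (subst (Crossing n) (List.++-assoc P N (B ∷ flatten o)) cr′)
      contra (inj₂ (a , b , c , a<b , b<c , c≤n , a~c , b~x , a≁b)) = go (Any.++⁻ (P ++ N) a~c)
        where
        b∈B : b ∈ B
        b∈B = notTop b~x (ℕ.≤-trans (ℕ.<⇒≤ b<c) c≤n)
        l≤b = proj₁ (All.lookup (proj₂ (proj₂ s)) b∈B)
        b≤m = proj₂ (All.lookup (proj₂ (proj₂ s)) b∈B)
        go : Same (P ++ N) a c ⊎ Same ((x ∷ B) ∷ flatten o) a c → ⊥
        go (inj₂ (here (here refl , _)))  = ℕ.<-irrefl refl (ℕ.<-trans a<b (ℕ.<-≤-trans b<c (ℕ.≤-trans c≤n (ℕ.n≤1+n n))))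
        go (inj₂ (here (there a∈B , _))) = a≁b (Any.++⁺ʳ (P ++ N) (here (there a∈B , there b∈B)))
        go (inj₂ (there same)) with M , M∈ , _ , c∈ ← find same =
          ℕ.<⇒≱ (ℕ.<-trans b<c (All.lookup (All.lookup bo M∈) c∈)) l≤b
        go (inj₁ same) with Any.++⁻ P same
        ... | inj₁ p with M , M∈ , a∈ , _ ← find p =
          ℕ.<⇒≱ (ℕ.≤-trans (proj₁ (All.lookup (proj₂ (All.lookup (bounds cut) M∈)) a∈)) (ℕ.<⇒≤ a<b)) b≤m
        ... | inj₂ p with M , M∈ , a∈ , c∈ ← find p =
          proj₂ (proj₂ (All.lookup nest M∈)) a∈ b∈B c∈ (ℕ.<⇒≤ a<b) (ℕ.<⇒≤ b<c)

    -- The crossing is `l < b < m < n + 1`, with the ends `l`, `m` of `B` and any element `b` of the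
    -- nested block that received `n + 1`.
    nested-crosses : ∀ {N′} → N′ ∈ insertEverywhere x N → Crossing x (P ++ N′ ++ B ∷ flatten o)
    nested-crosses N′∈ with left cut | ∈-insertEverywhere N N′∈
    ... | tower {l} {m} s nest tw | N₁ , M , N₂ , refl , refl with All.lookup nest (∈-++⁺ʳ N₁ (here refl))
    ...   | (b , b∈M) , bM , straddle =
      crosses (proj₁ (Tower-bounds tw)) (proj₁ (All.lookup bM b∈M)) (proj₂ (All.lookup bM b∈M)) (s≤s m≤n) ℕ.≤-refl
        (Any.++⁺ʳ P (Any.++⁺ʳ N′ (here (proj₁ s , proj₁ (proj₂ s)))))
        (Any.++⁺ʳ P (Any.++⁺ˡ (Any.++⁺ʳ N₁ (here (there b∈M , here refl)))))
        (go ∘ Any.++⁻ P)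
      where
      m≤n = ℕ.≤-pred (Path-≤ (right cut))
      N′  = N₁ ++ (x ∷ M) ∷ N₂
      l∉N : ∀ {M′} → M′ ∈ N₁ ++ M ∷ N₂ → ¬ (l ∈ M′)
      l∉N M′∈ l∈ = ℕ.<-irrefl refl (proj₁ (All.lookup (proj₁ (proj₂ (All.lookup nest M′∈))) l∈))
      go : Same P l b ⊎ Same (N′ ++ B ∷ flatten o) l b → ⊥
      go (inj₁ same) with M′ , M′∈ , l∈ , _ ← find same =
        ℕ.<⇒≱ (s≤s (Span-≤ s)) (proj₁ (All.lookup (proj₂ (All.lookup (bounds cut) M′∈)) l∈))
      go (inj₂ same) with Any.++⁻ N′ same
      ... | inj₂ (here (_ , b∈B)) = straddle b∈M b∈B b∈M ℕ.≤-refl ℕ.≤-refl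
      ... | inj₂ (there same₂) with M′ , M′∈ , l∈ , _ ← find same₂ =
        ℕ.<-irrefl refl (All.lookup (All.lookup (proj₂ (Tower-bounds tw)) M′∈) l∈)
      ... | inj₁ same₁ with Any.++⁻ N₁ same₁
      ...   | inj₁ p with M′ , M′∈ , l∈ , _ ← find p = l∉N (∈-++⁺ˡ M′∈) l∈
      ...   | inj₂ (here (here refl , _)) = ℕ.<⇒≱ (s≤s m≤n) (Span-≤ s)
      ...   | inj₂ (here (there l∈ , _)) = l∉N (∈-++⁺ʳ N₁ (here refl)) l∈
      ...   | inj₂ (there p) with M′ , M′∈ , l∈ , _ ← find p = l∉N (∈-++⁺ʳ N₁ (there M′∈)) l∈

  Apart-span : ∀ {G H l m l′ m′} → Span l m (concat G) → Span l′ m′ (concat H) → suc m ≢ l′ → suc m′ ≢ l → Apart G H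
  Apart-span s s′ p p′ =
    (λ e → p  (trans (cong suc (sym (Span-maxL s))) (trans e (Span-minL s′)))) ,
    (λ e → p′ (trans (cong suc (sym (Span-maxL s′))) (trans e (Span-minL s))))

  Tower-spans : ∀ {v o} → Tower v o → All (λ B → ∃₂ λ l m → Span l m B × m < v) (outerBlocks o)
  Tower-spans []                = []
  Tower-spans (tower s _ tw) = (_ , _ , s , ℕ.≤-refl) ∷
    All.map (λ (_ , _ , s′ , m<l) → _ , _ , s′ , ℕ.≤-trans m<l (ℕ.m≤n⇒m≤1+n (Span-≤ s))) (Tower-spans tw)

  sum-length-[_] : ∀ (A : List Block) → sum (map length (map [_] A)) ≡ length A
  sum-length-[ [] ]    = refl
  sum-length-[ B ∷ A ] = cong suc sum-length-[ A ]

  -- The enlarged block spans `l` to `n + 1`, so `A` loses its neighbours: its least element `m + 1`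
  -- no longer follows the maximum of `B`, and a later block starts above `n + 1`. Hence `A` is a
  -- chain of its own from now on.
  Cut-join : ∀ {n v P A N B o cl q} → Cut n v P A ((N , B) ∷ o) cl q →
             Valid (suc n) (state ((P ++ N , suc n ∷ B) ∷ o) (A ++ cl) (catalan (length A) ℕ.* q))
  Cut-join {n} {v} {P} {A} {N} {B} {o} {cl} {q} cut with left cut in left≡
  ... | tower {l} {m} s nest tw = record
    { left    = tower s⁺ (All.++⁺ (All.map fromRight (bounds cut)) (All.map fromNested nest)) tw
    ; right   = []
    ; bounds  = []
    ; blocks  = ↭-trans (shift (x ∷ B) (P ++ N) (flatten o)) (prep (x ∷ B)
        (↭-trans (drop-mid (P ++ N) A (↭-trans (↭-reflexive (List.++-assoc P N (B ∷ flatten o))) (blocks cut)))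
                 (shifts A (outerBlocks o))))
    ; chains  = subst (λ k → Chains (map [_] (A ++ cl)) (catalan k ℕ.* q)) sum-length-[ A ]
        (chain (right cut) apartA (chains cut) (↭-reflexive (List.map-++ [_] A cl)))
    ; apart   = subst (NonAdjacent _) (sym (List.map-++ [_] A cl))
        (All.++⁺ (All.map⁺ (All.tabulate (λ H∈ → newA H∈))) (All.tabulate newcl) ∷
         All.map⁺ (All.tabulate (λ B₂∈ → All.++⁺ (All.map⁺ (All.tabulate (oldA B₂∈))) (old B₂∈))))
    ; below   = subst (All _) (sym (List.map-++ [_] A cl)) (All.++⁺
        (All.map⁺ (All.tabulate (λ H∈ → let _ , _ , s′ , _ , m′<x = spanA H∈ in subst (_< x) (sym (Span-maxL s′)) m′<x)))
        (All.map ℕ.m≤n⇒m≤1+n (below cut)))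
    ; ¬crosses = join-¬crosses cut
    }
    where
    x   = suc n
    m≤n = ℕ.≤-pred (Path-≤ (right cut))
    s⁺ : Span l x (x ∷ B)
    s⁺ = there (proj₁ s) , here refl ,
      (ℕ.≤-trans (Span-≤ s) (ℕ.m≤n⇒m≤1+n m≤n) , ℕ.≤-refl) ∷
      All.map (λ (l≤y , y≤m) → l≤y , ℕ.≤-trans y≤m (ℕ.m≤n⇒m≤1+n m≤n)) (proj₂ (proj₂ s))
    fromRight : ∀ {M} → ∃ (_∈ M) × All (λ y → suc m ≤ y × y ≤ n) M → Nested (x ∷ B) l x M
    fromRight (y , b) = y , All.map (λ (m<y , y≤n) → ℕ.≤-trans (s≤s (Span-≤ s)) m<y , s≤s y≤n) b , λ where
      a∈ (here refl) c∈ a≤b b≤c → ℕ.<⇒≱ b≤c (proj₂ (All.lookup b c∈))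
      a∈ (there b∈)  c∈ a≤b b≤c → ℕ.<⇒≱ (proj₁ (All.lookup b a∈)) (ℕ.≤-trans a≤b (proj₂ (All.lookup (proj₂ (proj₂ s)) b∈)))
    fromNested : ∀ {M} → Nested B l m M → Nested (x ∷ B) l x M
    fromNested (y , b , straddle) = y , All.map (λ (l<y , y<m) → l<y , ℕ.≤-trans y<m (ℕ.m≤n⇒m≤1+n m≤n)) b , λ where
      a∈ (here refl) c∈ a≤b b≤c → ℕ.<⇒≱ b≤c (ℕ.≤-trans (ℕ.<⇒≤ (proj₂ (All.lookup b c∈))) m≤n)
      a∈ (there b∈)  c∈ a≤b b≤c → straddle a∈ b∈ c∈ a≤b b≤c
    apartA : NonAdjacent (map [_] A) (map [_] cl)
    apartA = All.++⁻ˡ (map [_] A) (subst (λ c → NonAdjacent c _) (List.map-++ [_] A _) (apart cut))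
    apartO : NonAdjacent (map [_] (B ∷ outerBlocks o)) (map [_] cl)
    apartO = All.++⁻ʳ (map [_] A) (subst (λ c → NonAdjacent c _) (List.map-++ [_] A _) (apart cut))
    spanA : ∀ {H} → H ∈ A → ∃₂ λ l′ m′ → Span l′ m′ (concat [ H ]) × suc m ≤ l′ × m′ < x
    spanA H∈ = Path-∈ (right cut) (∈-map⁺ [_] H∈)
    newA : ∀ {H} → H ∈ A → Apart [ x ∷ B ] [ H ]
    newA {H} H∈ with _ , _ , s′ , m<l′ , m′<x ← spanA H∈ = Apart-span {[ x ∷ B ]} {[ H ]} (Span-[ x ∷ B ] s⁺) s′
      (ℕ.>⇒≢ (ℕ.≤-trans (ℕ.≤-<-trans (Span-≤ s′) m′<x) (ℕ.n≤1+n x)))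
      (ℕ.>⇒≢ (s≤s (ℕ.≤-trans (Span-≤ s) (ℕ.≤-trans (ℕ.<⇒≤ m<l′) (Span-≤ s′)))))
    newcl : ∀ {H} → H ∈ map [_] cl → Apart [ x ∷ B ] H
    newcl {H} H∈ with _ , _ , s′ ← All.lookup (Chains-spanned (chains cut)) H∈ = Apart-span {[ x ∷ B ]} {H} (Span-[ x ∷ B ] s⁺) s′
      (ℕ.>⇒≢ (s≤s (ℕ.≤-trans (Span-≤ s′) (ℕ.≤-trans (ℕ.<⇒≤ (subst (_< n) (Span-maxL s′) (All.lookup (below cut) H∈))) (ℕ.n≤1+n n)))))
      -- The minimum of `x ∷ B` is still that of `B`, so an adjacency from the left would contradict
      -- the old `apart`.
      (λ e → proj₂ (All.lookup (All.head apartO) H∈)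
        (trans (cong suc (Span-maxL s′)) (trans e (sym (Span-minL (Span-[ B ] s))))))
    oldA : ∀ {B₂ H} → B₂ ∈ outerBlocks o → H ∈ A → Apart [ B₂ ] [ H ]
    oldA {B₂} {H} B₂∈ H∈ with _ , _ , s₂ , m₂<l ← All.lookup (Tower-spans tw) B₂∈ | _ , _ , s′ , m<l′ , _ ← spanA H∈ =
      Apart-span {[ B₂ ]} {[ H ]} (Span-[ B₂ ] s₂) s′
        (ℕ.<⇒≢ (ℕ.≤-trans (s≤s (ℕ.≤-trans m₂<l (Span-≤ s))) m<l′))
        (ℕ.>⇒≢ (s≤s (ℕ.≤-trans (Span-≤ s₂) (ℕ.≤-trans (ℕ.<⇒≤ m₂<l) (ℕ.≤-trans (Span-≤ s) (ℕ.≤-trans (ℕ.<⇒≤ m<l′) (Span-≤ s′)))))))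
    old : ∀ {B₂} → B₂ ∈ outerBlocks o → All (Apart [ B₂ ]) (map [_] cl)
    old B₂∈ = All.lookup (All.tail apartO) (∈-map⁺ [_] B₂∈)

  Valid-new : ∀ {n o cl q} → Valid n (state o cl q) → Valid (suc n) (state (([] , [ suc n ]) ∷ o) cl q)
  Valid-new {n} {o} {cl} cut = record
    { left    = tower s [] (left cut)
    ; right   = []
    ; bounds  = []
    ; blocks  = prep [ x ] (blocks cut)
    ; chains  = chains cut
    ; apart   = All.tabulate newcl ∷ apart cut
    ; below   = All.map ℕ.m≤n⇒m≤1+n (below cut)
    ; ¬crosses = λ cr → contra (Crossing-⊏⁻ new cr)
    }
    where
    x = suc n
    s : Span x x [ x ]
    s = here refl , here refl , (ℕ.≤-refl , ℕ.≤-refl) ∷ []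
    bo = proj₂ (Tower-bounds (left cut))
    newcl : ∀ {H} → H ∈ map [_] cl → Apart [ [ x ] ] H
    newcl {H} H∈ with _ , _ , s′ ← All.lookup (Chains-spanned (chains cut)) H∈ =
      let m′<n = subst (_< n) (Span-maxL s′) (All.lookup (below cut) H∈) in
      Apart-span {[ [ x ] ]} {H} (Span-[ [ x ] ] s) s′
        (ℕ.>⇒≢ (s≤s (ℕ.≤-trans (Span-≤ s′) (ℕ.≤-trans (ℕ.<⇒≤ m′<n) (ℕ.n≤1+n n)))))
        (ℕ.<⇒≢ (s≤s m′<n))
    contra : Crossing n (flatten o) ⊎ _ → ⊥
    contra (inj₁ cr) = ¬crosses cut cr
    contra (inj₂ (a , b , c , a<b , b<c , c≤n , a~c , here (here refl , _) , a≁b)) = ℕ.<⇒≱ b<c (ℕ.≤-trans c≤n (ℕ.n≤1+n n))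
    contra (inj₂ (a , b , c , a<b , b<c , c≤n , a~c , there b~x , a≁b)) with M , M∈ , _ , x∈ ← find b~x =
      ℕ.<-irrefl refl (All.lookup (All.lookup bo M∈) x∈)

  joinOuter-Valid : ∀ {n v P A} o {cl q} → Cut n v P A o cl q → All (Valid (suc n)) (joinOuter (suc n) P A o cl q)
  joinOuter-Valid []            cut = []
  joinOuter-Valid ((N , B) ∷ o) cut = Cut-join cut ∷ joinOuter-Valid o (proj₂ (Cut-advance cut))

  states-Valid : ∀ n → All (Valid n) (states n)
  states-Valid zero    = record
    { left = [] ; right = [] ; bounds = [] ; blocks = ↭-refl ; chains = [] ; apart = [] ; below = []
    ; ¬crosses = λ cr → ℕ.<⇒≱ (Crossing.c<d cr) (ℕ.≤-trans (Crossing.d≤n cr) z≤n) } ∷ []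
  states-Valid (suc n) = All.concat⁺ (All.map⁺ (All.map
    (λ { {state o cl q} cut → Valid-new cut ∷ joinOuter-Valid o cut }) (states-Valid n)))

  filter-insertEverywhere : ∀ {n v P A} o {cl q} → Cut n v P A o cl q →
    filterᵇ (noncrossing (suc n)) (map (P ++_) (insertEverywhere (suc n) (flatten o))) ≡
    map partition (joinOuter (suc n) P A o cl q)
  filter-insertEverywhere []                              cut = refl
  filter-insertEverywhere {n} {v} {P} {A} ((N , B) ∷ o) {cl} {q} cut = begin
    filterᵇ p (map (P ++_) (insertEverywhere x (N ++ B ∷ flatten o)))
      ≡⟨ cong (filterᵇ p ∘ map (P ++_)) (insertEverywhere-++ x N B (flatten o)) ⟩
    filterᵇ p (map (P ++_) (map (_++ B ∷ flatten o) ins ++ rest))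
      ≡⟨ cong (filterᵇ p) (List.map-++ (P ++_) (map (_++ B ∷ flatten o) ins) rest) ⟩
    filterᵇ p (map (P ++_) (map (_++ B ∷ flatten o) ins) ++ map (P ++_) rest)
      ≡⟨ filterᵇ-++ p (map (P ++_) (map (_++ B ∷ flatten o) ins)) (map (P ++_) rest) ⟩
    filterᵇ p (map (P ++_) (map (_++ B ∷ flatten o) ins)) ++ filterᵇ p (map (P ++_) rest)
      ≡⟨ cong₂ _++_ (filterᵇ-none p (All.map⁺ (All.map⁺ (All.tabulate
           (λ N′∈ → Crossing⇒noncrossing≡false (nested-crosses cut N′∈))))))
         (cong (λ π → filterᵇ p (π ∷ map (P ++_) (map ((N ++ [ B ]) ++_) (insertEverywhere x (flatten o)))))
               (sym (List.++-assoc P N _))) ⟩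
    filterᵇ p (((P ++ N) ++ (x ∷ B) ∷ flatten o) ∷ map (P ++_) (map ((N ++ [ B ]) ++_) (insertEverywhere x (flatten o))))
      ≡⟨ filterᵇ-accept p (map (P ++_) (map ((N ++ [ B ]) ++_) (insertEverywhere x (flatten o)))) (¬Crossing⇒noncrossing≡true (join-¬crosses cut)) ⟩
    ((P ++ N) ++ (x ∷ B) ∷ flatten o) ∷ filterᵇ p (map (P ++_) (map ((N ++ [ B ]) ++_) (insertEverywhere x (flatten o))))
      ≡⟨ cong (λ l → ((P ++ N) ++ (x ∷ B) ∷ flatten o) ∷ filterᵇ p l)
           (trans (sym (List.map-∘ (insertEverywhere x (flatten o))))
                  (List.map-cong (λ π → sym (List.++-assoc P (N ++ [ B ]) π)) (insertEverywhere x (flatten o)))) ⟩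
    ((P ++ N) ++ (x ∷ B) ∷ flatten o) ∷ filterᵇ p (map ((P ++ N ++ [ B ]) ++_) (insertEverywhere x (flatten o)))
      ≡⟨ cong (((P ++ N) ++ (x ∷ B) ∷ flatten o) ∷_) (filter-insertEverywhere o (proj₂ (Cut-advance cut))) ⟩
    map partition (joinOuter x P A ((N , B) ∷ o) cl q) ∎
    where
    open ≡-Reasoning
    x    = suc n
    p    = noncrossing x
    ins  = insertEverywhere x N
    rest = (N ++ (x ∷ B) ∷ flatten o) ∷ map ((N ++ [ B ]) ++_) (insertEverywhere x (flatten o))

  NC≡states : ∀ n → NC n ≡ map partition (states n)
  NC≡states zero    = refl
  NC≡states (suc n) = begin
    filterᵇ (noncrossing x) (concatMap extensions (partitions n))
      ≡⟨ filterᵇ-concatMap (noncrossing x) extensions (partitions n) ⟩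
    concatMap kept (partitions n)
      -- A crossing survives every extension, so crossing partitions of [n] can be discarded before
      -- extending.
      ≡⟨ concatMap-filterᵇ (noncrossing n) kept dropped (partitions n) ⟩
    concatMap kept (NC n)
      ≡⟨ cong (concatMap kept) (NC≡states n) ⟩
    concatMap kept (map partition (states n))
      ≡⟨ List.concatMap-map kept partition (states n) ⟩
    concatMap (kept ∘ partition) (states n)
      ≡⟨ concatMap-cong-All (All.map kept-extend (states-Valid n)) ⟩
    concatMap (map partition ∘ extend x) (states n)
      ≡⟨ List.map-concatMap partition (extend x) (states n) ⟨
    map partition (states (suc n)) ∎
    where
    open ≡-Reasoning
    x = suc n
    extensions kept : Partition → List Partition
    extensions π = ([ x ] ∷ π) ∷ insertEverywhere x π
    kept = filterᵇ (noncrossing x) ∘ extensions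
    dropped : ∀ π → noncrossing n π ≡ false → kept π ≡ []
    dropped π e = filterᵇ-none (noncrossing x) (Crossing⇒noncrossing≡false (Crossing-⊏ new cr) ∷ All.tabulate λ π′∈ → later π′∈)
      where
      cr = noncrossing≡false⇒Crossing n π e
      later : ∀ {π′} → π′ ∈ insertEverywhere x π → noncrossing x π′ ≡ false
      later π′∈ with π₁ , B , π₂ , refl , refl ← ∈-insertEverywhere π π′∈ =
        Crossing⇒noncrossing≡false (Crossing-⊏ (join π₁) cr)
    kept-extend : ∀ {st} → Valid n st → kept (partition st) ≡ map partition (extend x st)
    kept-extend {state o cl q} cut = trans
      (filterᵇ-accept (noncrossing x) (insertEverywhere x (flatten o)) (¬Crossing⇒noncrossing≡true (¬crosses (Valid-new cut))))
      (cong (([ x ] ∷ flatten o) ∷_) (trans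
        (cong (filterᵇ (noncrossing x)) (sym (List.map-id (insertEverywhere x (flatten o)))))
        (filter-insertEverywhere o cut)))

  -- Advancing the cut to the far left gathers all outer blocks in `A`, one chain beside those of
  -- `cl`, to which `catalanCoeff-Chains` applies.
  Cut-catalanCoeff : ∀ {n v P A} o {cl q} → Cut n v P A o cl q →
                     catalanCoeff (P ++ flatten o) ≡ catalan (length A ℕ.+ length o) ℕ.* q
  Cut-catalanCoeff {P = P} {A} [] {cl} {q} cut = catalanCoeff-Chains (P ++ [])
    (subst (λ k → Chains (map [_] (P ++ [])) (catalan k ℕ.* q)) (trans sum-length-[ A ] (sym (ℕ.+-identityʳ (length A))))
      (chain (right cut)
        (subst (λ A′ → NonAdjacent (map [_] A′) _) (List.++-identityʳ A) (apart cut)) (chains cut)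
        (↭-trans (map⁺ [_] (blocks cut)) (↭-reflexive (List.map-++ [_] A cl)))))
  Cut-catalanCoeff {P = P} {A} ((N , B) ∷ o) {cl} {q} cut = begin
    catalanCoeff (P ++ N ++ B ∷ flatten o)
      ≡⟨ cong catalanCoeff (trans (List.++-assoc P (N ++ [ B ]) (flatten o))
           (cong (P ++_) (List.++-assoc N [ B ] (flatten o)))) ⟨
    catalanCoeff ((P ++ N ++ [ B ]) ++ flatten o)
      ≡⟨ Cut-catalanCoeff o (proj₂ (Cut-advance cut)) ⟩
    catalan (suc (length A ℕ.+ length o)) ℕ.* q
      ≡⟨ cong (λ k → catalan k ℕ.* q) (ℕ.+-suc (length A) (length o)) ⟨
    catalan (length A ℕ.+ suc (length o)) ℕ.* q ∎
    where open ≡-Reasoning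

-- Summation over the noncrossing partitions.

module NoncrossingSum {c ℓ : Level} (R : CommutativeRing c ℓ) (a : ℕ → CommutativeRing.Carrier R) where
  open NoncrossingPartitions
  open CommutativeRing R
  open Series R
  open PowerSeries R
  open CatalanSeries R
  open TransferSeries R (λ s → - a s)
  open RingProperties ring using (-‿distribˡ-*)
  open SetoidReasoning setoid
  private module S = NaturalCoefficients commutativeSemiring

  sumOver : ∀ {A : Set} → (A → Carrier) → List A → Carrier
  sumOver f = sumL ∘ map f

  sumOver-++ : ∀ {A : Set} (f : A → Carrier) xs ys → sumOver f (xs ++ ys) ≈ sumOver f xs + sumOver f ys
  sumOver-++ f []       ys = sym (+-identityˡ _)
  sumOver-++ f (x ∷ xs) ys = trans (+-congˡ (sumOver-++ f xs ys)) (sym (+-assoc _ _ _))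

  sumOver-concatMap : ∀ {A B : Set} (f : B → Carrier) (g : A → List B) xs →
                      sumOver f (concatMap g xs) ≈ sumOver (sumOver f ∘ g) xs
  sumOver-concatMap f g []       = refl
  sumOver-concatMap f g (x ∷ xs) = trans (sumOver-++ f (g x) (concatMap g xs)) (+-congˡ (sumOver-concatMap f g xs))

  sumOver-cong : ∀ {A : Set} {f g : A → Carrier} {xs} → All (λ x → f x ≈ g x) xs → sumOver f xs ≈ sumOver g xs
  sumOver-cong []       = refl
  sumOver-cong (e ∷ es) = +-cong e (sumOver-cong es)

  blockWeight : Partition → Carrier
  blockWeight π = weight (map length π)

  blockWeight-++ : ∀ π ρ → blockWeight (π ++ ρ) ≈ blockWeight π * blockWeight ρ
  blockWeight-++ []      ρ = sym (*-identityˡ _)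
  blockWeight-++ (B ∷ π) ρ = trans (*-congˡ (blockWeight-++ π ρ)) (sym (*-assoc _ _ _))

  blockWeight-↭ : ∀ {π ρ} → π ↭ ρ → blockWeight π ≈ blockWeight ρ
  blockWeight-↭ ↭.refl         = refl
  blockWeight-↭ (prep B e)     = *-congˡ (blockWeight-↭ e)
  blockWeight-↭ (swap B C e)   = trans (*-congˡ (*-congˡ (blockWeight-↭ e)))
    (S.solve 3 (λ x y z → x S.:* (y S.:* z) S.:= y S.:* (x S.:* z)) refl _ _ _)
  blockWeight-↭ (↭.trans e e′) = trans (blockWeight-↭ e) (blockWeight-↭ e′)

  signPow-blockWeight : ∀ π → signPow (length π) * prodL (map (λ B → a (length B)) π) ≈ blockWeight π
  signPow-blockWeight []      = *-identityˡ _
  signPow-blockWeight (B ∷ π) = begin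
    - σ * (a (length B) * p)    ≈⟨ -‿distribˡ-* σ _ ⟨
    - (σ * (a (length B) * p))  ≈⟨ -‿cong (S.solve 3 (λ x y z → x S.:* (y S.:* z) S.:= y S.:* (x S.:* z)) refl _ _ _) ⟩
    - (a (length B) * (σ * p))  ≈⟨ -‿distribˡ-* (a (length B)) _ ⟩
    - a (length B) * (σ * p)    ≈⟨ *-congˡ (signPow-blockWeight π) ⟩
    blockWeight (B ∷ π)         ∎
    where
    σ = signPow (length π)
    p = prodL (map (λ B → a (length B)) π)

  term : Partition → Carrier
  term π = signPow (length π) * (fromℕ (catalanCoeff π) * prodL (map (λ B → a (length B)) π))

  sizes : List Entry → List ℕ
  sizes o = map length (outerBlocks o)

  settled : List Block → ℕ → Carrier
  settled cl q = fromℕ q * blockWeight cl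

  -- The total contribution of the partitions of [n + m] that restrict to a given partition of [n].
  completions : ℕ → State → Carrier
  completions m (state o cl q) = settled cl q * Z (sizes o) m

  term≈completions : ∀ {n} st → Valid n st → term (partition st) ≈ completions 0 st
  term≈completions (state o cl q) cut = begin
    signPow (length π) * (fromℕ (catalanCoeff π) * prodL (map (λ B → a (length B)) π))
      ≈⟨ S.solve 3 (λ x y z → x S.:* (y S.:* z) S.:= y S.:* (x S.:* z)) refl _ _ _ ⟩
    fromℕ (catalanCoeff π) * (signPow (length π) * prodL (map (λ B → a (length B)) π))
      ≈⟨ *-cong (trans (fromℕ-cong (Cut-catalanCoeff o cut)) (fromℕ-* (catalan (length o)) q)) (signPow-blockWeight π) ⟩
    catSer (length o) * fromℕ q * blockWeight π
      ≈⟨ *-congˡ (trans (blockWeight-↭ (Cut.blocks cut)) (blockWeight-++ (outerBlocks o) cl)) ⟩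
    catSer (length o) * fromℕ q * (weight (sizes o) * blockWeight cl)
      ≈⟨ S.solve 4 (λ c q w b → c S.:* q S.:* (w S.:* b) S.:= q S.:* b S.:* (c S.:* w)) refl _ _ _ _ ⟩
    settled cl q * (catSer (length o) * weight (sizes o))
      ≈⟨ *-congˡ (*-congʳ (fromℕ-cong (≡.cong catalan
           (≡.trans (List.length-map length (outerBlocks o)) (List.length-map proj₂ o))))) ⟨
    settled cl q * (catSer (length (sizes o)) * weight (sizes o))
      ≈⟨ *-congˡ (Z-zero (sizes o)) ⟨
    settled cl q * Z (sizes o) 0 ∎
    where π = flatten o

  -- `joins` accumulates weights on the right, `blockWeight` on the left, so `p` is tied to `A` only
  -- up to `≋`.
  sumOver-joinOuter : ∀ m x P A o cl q p → p ≋ const (blockWeight A) →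
    sumOver (completions m) (joinOuter x P A o cl q) ≈ settled cl q * joins (length A) p (sizes o) m
  sumOver-joinOuter m x P A []            cl q p e = sym (zeroʳ _)
  sumOver-joinOuter m x P A ((N , B) ∷ o) cl q p e = begin
    settled (A ++ cl) (catalan k ℕ.* q) * z m + sumOver (completions m) (joinOuter x (P ++ N ++ [ B ]) (B ∷ A) o cl q)
      ≈⟨ +-cong (*-congʳ (*-cong (fromℕ-* (catalan k) q) (blockWeight-++ A cl)))
           (sumOver-joinOuter m x (P ++ N ++ [ B ]) (B ∷ A) o cl q (p · const w) e′) ⟩
    catSer k * fromℕ q * (blockWeight A * blockWeight cl) * z m + settled cl q * r
      ≈⟨ S.solve 6 (λ c q b d z r → c S.:* q S.:* (b S.:* d) S.:* z S.:+ q S.:* d S.:* r S.:=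
             q S.:* d S.:* (c S.:* (b S.:* z) S.:+ r)) refl _ _ _ _ _ _ ⟩
    settled cl q * (catSer k * (blockWeight A * z m) + r)
      ≈⟨ *-congˡ (+-congʳ (trans (const-· (catSer k) (p · z) m) (*-congˡ (trans (·-cong {g = z} e ≋-refl m)
           (const-· (blockWeight A) z m))))) ⟨
    settled cl q * joins k p (sizes ((N , B) ∷ o)) m ∎
    where
    k = length A
    w = - a (length B)
    z = Z (suc (length B) ∷ sizes o)
    r = joins (suc k) (p · const w) (sizes o) m
    e′ : (p · const w) ≋ const (blockWeight (B ∷ A))
    e′ = ≋-trans (·-cong {g = const w} e ≋-refl) (≋-trans (·-comm (const (blockWeight A)) (const w))
           (≋-sym (const-* w (blockWeight A))))

  sumOver-extend : ∀ m x st → sumOver (completions m) (extend x st) ≈ completions (suc m) st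
  sumOver-extend m x (state o cl q) = begin
    settled cl q * Z (1 ∷ sizes o) m + sumOver (completions m) (joinOuter x [] [] o cl q)
      ≈⟨ +-congˡ (sumOver-joinOuter m x [] [] o cl q one (≋-sym const-1)) ⟩
    settled cl q * Z (1 ∷ sizes o) m + settled cl q * joins 0 one (sizes o) m
      ≈⟨ distribˡ _ _ _ ⟨
    settled cl q * (Z (1 ∷ sizes o) m + joins 0 one (sizes o) m)
      ≈⟨ *-congˡ (Z-suc (sizes o) m) ⟨
    settled cl q * Z (sizes o) (suc m) ∎

  -- Inserting one more element trades a unit of `m` for a unit of `n` without changing the sum,
  -- which therefore equals its value at the empty partition.
  sumOver-states : ∀ n m → sumOver (completions m) (states n) ≈ D (n ℕ.+ m)
  sumOver-states zero    m = begin
    settled [] 1 * Z [] m + 0#  ≈⟨ +-identityʳ _ ⟩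
    settled [] 1 * Z [] m       ≈⟨ *-congʳ (trans (*-identityʳ _) fromℕ-1) ⟩
    1# * Z [] m                 ≈⟨ *-identityˡ _ ⟩
    Z [] m                      ≈⟨ Z[]≋D m ⟩
    D m                         ∎
  sumOver-states (suc n) m = begin
    sumOver (completions m) (concatMap (extend (suc n)) (states n))
      ≈⟨ sumOver-concatMap (completions m) (extend (suc n)) (states n) ⟩
    sumOver (sumOver (completions m) ∘ extend (suc n)) (states n)
      ≈⟨ sumOver-cong (All.universal (sumOver-extend m (suc n)) (states n)) ⟩
    sumOver (completions (suc m)) (states n)
      ≈⟨ sumOver-states n (suc m) ⟩
    D (n ℕ.+ suc m)
      ≈⟨ reflexive (≡.cong D (ℕ.+-suc n m)) ⟩
    D (suc n ℕ.+ m) ∎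

  ncFormula≈D : ∀ n → ncFormula a n ≈ D n
  ncFormula≈D n = begin
    sumOver term (NC n)
      ≈⟨ reflexive (≡.cong (sumOver term) (NC≡states n)) ⟩
    sumOver term (map partition (states n))
      ≈⟨ reflexive (≡.cong sumL (List.map-∘ (states n))) ⟨
    sumOver (term ∘ partition) (states n)
      ≈⟨ sumOver-cong (All.map (term≈completions _) (states-Valid n)) ⟩
    sumOver (completions 0) (states n)
      ≈⟨ sumOver-states n 0 ⟩
    D (n ℕ.+ 0)
      ≈⟨ reflexive (≡.cong D (ℕ.+-identityʳ n)) ⟩
    D n ∎

theorem5p4 : {c ℓ : Level} (R : CommutativeRing c ℓ) (a b : ℕ → CommutativeRing.Carrier R) →
    Series.IsCompInverse R (Series.shiftSer R a) (Series.shiftSer R b)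
    ⇔ (∀ n → CommutativeRing._≈_ R (b (suc n)) (Series.ncFormula R a (suc n)))
theorem5p4 R a b = mk⇔
  (λ inv n → trans (to inv n) (sym (ncFormula≈D (suc n))))
  (λ e → from (λ n → trans (e n) (ncFormula≈D (suc n))))
  where
  open CommutativeRing R using (trans; sym)
  open NoncrossingSum R a
  open Equivalence (CompositionalInverse.isCompInverse⇔ R a b)
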